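{- Let $n > 0$ be even. Let $\delta_3(n) = 1$ if $n$ has a prime factor $p > 3$ with $p \equiv 3 \pmod 4$, and $\delta_3(n) = 0$ otherwise. Then $$\mathrm{diam}(G_n) = \begin{cases} 12, & \text{if } n \text{ is a multiple of } 24;\\ 6, & \text{if } n \text{ is an odd multiple of } 12;\\ 5, & \text{if } n \text{ is a multiple of } 10, \text{ but not of } 12;\\ 4, & \text{if } n = 8K \text{ for some integer } K>0 \text{ coprime to } 15;\\ 3+\delta_3(n), & \text{if } n = 6K \text{ for some integer } K > 0 \text{ coprime to } 10;\\ 3+\delta_3(n), & \text{if } n=4K \text{ for some integer } K > 1 \text{ coprime to } 30;\\ 3, & \text{if } n = 2K \text{ for some integer } K>1 \text{ coprime to } 30;\\ 2, & \text{if } n=4;\\ 1, & \text{if } n = 2.\end{cases}$$ In particular (together with the case of odd $n$), $\mathrm{diam}(G_n) \le 12$ for all $n \ge 1$, and $\mathrm{diam}(G_{p^m}) \le 4$ for any prime $p$ and $m \ge 0$.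
   Context: For an integer $n \ge 1$, $Q_n = \{u^2 : u \in \mathbb{Z}_n^\times\}$ and $T_n = \pm Q_n = \{\pm u^2 : u \in \mathbb{Z}_n^\times\}$. The quadratic unitary Cayley graph $G_n = \mathrm{Cay}(\mathbb{Z}_n, T_n)$ is the undirected graph with vertex set $\mathbb{Z}_n$ in which $a,b$ are adjacent iff $a-b \in T_n$. $\mathrm{diam}$ denotes the graph diameter. -}

module Defs where

open import Data.Bool.Base using (if_then_else_)
open import Data.Fin.Base using (Fin; toℕ)
open import Data.Nat.Base using (ℕ; suc; _+_; _*_; _∸_; _≤_; _<_; _>_; s≤s; NonZero)
open import Data.Nat.Coprimality using (Coprime)
open import Data.Nat.Divisibility using (_∣_; _∣?_; ∣⇒≤)
open import Data.Nat.DivMod using (_%_; _mod_)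
open import Data.Nat.Primality using (Prime; prime?)
open import Data.Nat.Properties using (_≟_; _<?_; anyUpTo?)
open import Data.Product.Base using (_×_; _,_; ∃; ∃-syntax)
open import Data.Sum.Base using (_⊎_)
open import Level using (0ℓ)
open import Relation.Binary.Construct.Closure.ReflexiveTransitive using (Star; ε; _◅_)
open import Relation.Binary.Core using (Rel)
open import Relation.Binary.PropositionalEquality.Core using (_≡_)
open import Relation.Nullary.Decidable using (Dec; does; map′; _×-dec_)
open import Relation.Nullary.Negation.Core using (¬_)
open import Relation.Unary using (Pred; _∈_)

module Graph {V : Set} (_~_ : Rel V 0ℓ) where

  Walk : Rel V 0ℓ
  Walk = Star _~_

  length : ∀ {x y} → Walk x y → ℕ
  length ε       = 0
  length (_ ◅ w) = suc (length w)

  HasDistance : V → V → ℕ → Set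
  HasDistance x y d = (∃[ w ] length {x} {y} w ≡ d) × (∀ (w : Walk x y) → d ≤ length w)

  -- Diameter as the maximum of all distances; in particular the graph is
  -- non-empty and connected.
  HasDiameter : ℕ → Set
  HasDiameter d =
    (∀ x y → ∃[ k ] HasDistance x y k × k ≤ d) × (∃[ x ] ∃[ y ] HasDistance x y d)

open Graph public using (HasDiameter)

-- The ring ℤ/nℤ, on the representatives 0, …, n ∸ 1.
ℤmod : ℕ → Set
ℤmod n = Fin n

module _ {n : ℕ} .{{_ : NonZero n}} where

  infixl 7 _*ₙ_
  infixl 6 _+ₙ_ _-ₙ_
  infix  8 -ₙ_

  1ₙ : ℤmod n
  1ₙ = 1 mod n

  _+ₙ_ _*ₙ_ : ℤmod n → ℤmod n → ℤmod n
  a +ₙ b = (toℕ a + toℕ b) mod n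
  a *ₙ b = (toℕ a * toℕ b) mod n

  -ₙ_ : ℤmod n → ℤmod n
  -ₙ a = (n ∸ toℕ a) mod n

  _-ₙ_ : ℤmod n → ℤmod n → ℤmod n
  a -ₙ b = a +ₙ (-ₙ b)

  IsUnit : Pred (ℤmod n) 0ℓ
  IsUnit u = ∃[ v ] u *ₙ v ≡ 1ₙ

  Cay : Pred (ℤmod n) 0ℓ → Rel (ℤmod n) 0ℓ
  Cay S a b = (a -ₙ b) ∈ S

module _ (n : ℕ) .{{_ : NonZero n}} where

  Q : Pred (ℤmod n) 0ℓ
  Q x = ∃[ u ] IsUnit u × x ≡ u *ₙ u

  T : Pred (ℤmod n) 0ℓ
  T x = ∃[ q ] q ∈ Q × (x ≡ q ⊎ x ≡ -ₙ q)

  -- For n = 1 the only vertex carries a loop (0 ∈ T 1), which does not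
  -- affect distances.
  G : Rel (ℤmod n) 0ℓ
  G = Cay T

HasPrimeFactor3mod4 : ℕ → Set
HasPrimeFactor3mod4 n = ∃[ p ] Prime p × p ∣ n × p > 3 × p % 4 ≡ 3

hasPrimeFactor3mod4? : ∀ n .{{_ : NonZero n}} → Dec (HasPrimeFactor3mod4 n)
hasPrimeFactor3mod4? n =
  map′ (λ (p , _ , h) → p , h)
       (λ (p , pr , p∣n , h) → p , s≤s (∣⇒≤ p∣n) , pr , p∣n , h)
       (anyUpTo? (λ p → prime? p ×-dec p ∣? n ×-dec 3 <? p ×-dec p % 4 ≟ 3) (suc n))

δ₃ : ∀ n .{{_ : NonZero n}} → ℕ
δ₃ n = if does (hasPrimeFactor3mod4? n) then 1 else 0

-- EvenCase n d: some row of the case distinction applies to n and has value d.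
data EvenCase (n : ℕ) .{{_ : NonZero n}} : ℕ → Set where
  multiple-of-24     : 24 ∣ n → EvenCase n 12
  odd-multiple-of-12 : ∀ k → n ≡ (2 * k + 1) * 12 → EvenCase n 6
  multiple-of-10     : 10 ∣ n → ¬ (12 ∣ n) → EvenCase n 5
  form-8K            : ∀ K → K > 0 → Coprime K 15 → n ≡ 8 * K → EvenCase n 4
  form-6K            : ∀ K → K > 0 → Coprime K 10 → n ≡ 6 * K → EvenCase n (3 + δ₃ n)
  form-4K            : ∀ K → K > 1 → Coprime K 30 → n ≡ 4 * K → EvenCase n (3 + δ₃ n)
  form-2K            : ∀ K → K > 1 → Coprime K 30 → n ≡ 2 * K → EvenCase n 3
  is-4               : n ≡ 4 → EvenCase n 2
  is-2               : n ≡ 2 → EvenCase n 1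

{-# OPTIONS --safe #-}

-- The vertices a and b are joined by a walk of length k iff a − b is a sum of k
-- signed unit squares modulo n.  By the Chinese remainder theorem and Hensel's
-- lemma (from p to pᵏ for odd p, from 8 to 2ᵏ) this is a question modulo 8 and
-- modulo the odd primes dividing n.  Unit squares are 1 modulo 24, so at 2 and 3
-- only the sum of the signs matters.  Unit squares are ± 1 modulo 5, and four of
-- them reach everything.  Modulo a prime p ≥ 7, u² − v² reaches everything, and so
-- do ± (u² + v² + w²); u² + v² reaches 0 iff − 1 is a square, i.e. iff p ≢ 3
-- (mod 4).  For the upper bounds it remains to choose signs for each residue
-- modulo gcd (n, 24).  The lower bounds come from the vertices 12, 6, 5, 4, 3, 2
-- and 1, from odd nonunits, and from 2p with p ≡ 3 (mod 4).
module Submission where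

open import Defs

-- One sign pattern has to serve all primes dividing n at once: the Chinese remainder theorem glues
-- units chosen independently at each prime, but it cannot mix different signs. This is why a
-- representation carries a list of signs fixed in advance, and the diameter is governed by the
-- conflict between the local demands on that list. For example, 2p with p ≡ 3 (mod 4) admits two
-- terms modulo 4 only with equal signs and modulo p only with opposite ones, whence the summand
-- `δ₃`. Without a square root of -1 every nonzero class is ± a², because squaring is then injective
-- up to sign. The criterion for -1 comes from a parity count of pairs with product ± 1, so that
-- neither primitive roots nor powers with exponent (p - 1) / 2 enter.

module Representations where

  open import Algebra.Bundles using (CommutativeRing)
  open import Data.Bool.Base using (Bool; true; false; not; _xor_)
  open import Data.Bool.Properties using (xor-∧-commutativeRing; xor-assoc; xor-same; not-involutive)
  open import Data.Fin.Base as Fin using (Fin; zero; suc; toℕ; fromℕ<; punchOut)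
  open import Data.Fin.Properties as Fin using (toℕ<n; toℕ-fromℕ<; punchOut-injective; injective⇒≤; any?; all?; toℕ-injective; ¬∀⟶∃¬)
  open import Data.Integer.Base as ℤ using (ℤ; +_; -[1+_]; _+_; _*_; _-_; -_; 0ℤ; 1ℤ; -1ℤ) renaming (∣_∣ to abs)
  open import Data.Integer.Divisibility.Signed
  open import Data.Integer.DivMod using (_%ℕ_; _/ℕ_; n%ℕd<d; a≡a%ℕn+[a/ℕn]*n)
  import Data.Integer.Properties as ℤ
  open import Data.Integer.Solver using (module +-*-Solver)
  import Data.Integer.Tactic.RingSolver as ℤ
  open import Data.List.Base as List using (List; []; _∷_; _++_; map; replicate)
  open import Data.List.Relation.Unary.All as All using (All; []; _∷_)
  open import Data.List.Relation.Unary.Any as Any using (Any; here; there)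
  open import Data.List.Relation.Unary.Any.Properties as Any using ()
  open import Data.Nat.Base as ℕ using (ℕ; NonZero; zero; suc)
  open import Data.Nat.Coprimality as Coprime using (Coprime)
  import Data.Nat.Divisibility as ℕ
  open import Data.Nat.DivMod using (_%_; _mod_; m%n<n; [m+kn]%n≡m%n)
  open import Data.Nat.GCD using (gcd; gcd[m,n]∣m; gcd[m,n]∣n; gcd-greatest; module Bézout)
  open import Data.Nat.Induction using (<-rec)
  open import Data.Nat.ListAction using (product)
  open import Data.Nat.ListAction.Properties using (∈⇒∣product)
  open import Data.Nat.Primality
  open import Data.Nat.Primality.Factorisation using (factorise; PrimeFactorisation)
  import Data.Nat.Properties as ℕ
  open import Data.Nat.Tactic.RingSolver using (solve-∀)
  open import Data.Product.Base using (_×_; _,_; proj₁; proj₂; ∃-syntax)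
  open import Data.Sign.Base as Sign using (Sign)
  open import Data.Sum.Base using (_⊎_; inj₁; inj₂; [_,_]′; fromInj₁)
  open import Function.Base using (_∘_; id)
  open import Function.Definitions using (Injective)
  open import Level using (0ℓ)
  open import Relation.Binary.Construct.Closure.ReflexiveTransitive as Star using (_◅_)
  open import Relation.Binary.Core using (Rel)
  open import Relation.Binary.Definitions using (Decidable)
  open import Relation.Binary.PropositionalEquality
  open import Relation.Nullary
  open import Relation.Nullary.Decidable hiding (map)
  open import Relation.Unary using (_∈_)

  open +-*-Solver using (con; _:+_; _:*_; _:-_; :-_; _:=_) renaming (solve to ring)
  open CommutativeRing xor-∧-commutativeRing using () renaming (+-commutativeMonoid to xor-monoid)
  open import Algebra.Properties.CommutativeMonoid.Sum xor-monoid using (sum; sum-cong-≗; ∑-distrib-+)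

  -- Integer congruences, units and sums of signed unit squares

  infix 4 _≋_[mod_]

  _≋_[mod_] : ℤ → ℤ → ℤ → Set
  x ≋ y [mod m ] = m ∣ x - y

  -- Divisibility goals are reduced to polynomial identities: the goal is exhibited as a combination
  -- of known multiples of `m` with explicit coefficients, and the equation is left to the ring
  -- solver.
  ∣-lin₁ : ∀ {m a t} c → m ∣ a → t ≡ c * a → m ∣ t
  ∣-lin₁ c m∣a refl = ∣n⇒∣m*n c m∣a

  ∣-lin₂ : ∀ {m a b t} c d → m ∣ a → m ∣ b → t ≡ c * a + d * b → m ∣ t
  ∣-lin₂ c d m∣a m∣b refl = ∣m∣n⇒∣m+n (∣n⇒∣m*n c m∣a) (∣n⇒∣m*n d m∣b)

  ≋-reflexive : ∀ {m x y} → x ≡ y → x ≋ y [mod m ]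
  ≋-reflexive {x = x} refl = divides 0ℤ (ℤ.+-inverseʳ x)

  ≋-sym : ∀ {m} x y → x ≋ y [mod m ] → y ≋ x [mod m ]
  ≋-sym x y h = ∣-lin₁ -1ℤ h (ring 2 (λ x y → y :- x := con -1ℤ :* (x :- y)) refl x y)

  ≋-trans : ∀ {m} x y z → x ≋ y [mod m ] → y ≋ z [mod m ] → x ≋ z [mod m ]
  ≋-trans x y z h k = ∣-lin₂ 1ℤ 1ℤ h k
    (ring 3 (λ x y z → x :- z := con 1ℤ :* (x :- y) :+ con 1ℤ :* (y :- z)) refl x y z)

  small-multiple : ∀ {n m} → n ℕ.∣ m → m ℕ.< n → m ≡ 0
  small-multiple {m = zero}  _   _   = refl
  small-multiple {m = suc _} n∣m m<n = contradiction (ℕ.∣⇒≤ n∣m) (ℕ.<⇒≱ m<n)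

  ≋⇒≡ : ∀ {n i j} → i ℕ.< n → j ℕ.< n → + i ≋ + j [mod + n ] → i ≡ j
  ≋⇒≡ {n} {i} {j} i<n j<n i≋j = ℤ.+-injective (ℤ.i-j≡0⇒i≡j (+ i) (+ j)
    (ℤ.∣i∣≡0⇒i≡0 (small-multiple (∣⇒∣ᵤ i≋j) (begin-strict
      abs (+ i - + j) ≡⟨ cong abs (ℤ.m-n≡m⊖n i j) ⟩
      abs (i ℤ.⊖ j)   ≤⟨ ℤ.∣m⊝n∣≤m⊔n i j ⟩
      i ℕ.⊔ j         <⟨ ℕ.⊔-lub i<n j<n ⟩
      n               ∎))))
    where open ℕ.≤-Reasoning

  private
    cancel : ∀ k y → k + y - k ≡ y
    cancel = ℤ.solve-∀
    +-split : ∀ x y x′ y′ → x + y - (x′ + y′) ≡ 1ℤ * (x - x′) + 1ℤ * (y - y′)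
    +-split = ℤ.solve-∀
    *-split : ∀ x y x′ y′ → x * y - x′ * y′ ≡ y * (x - x′) + x′ * (y - y′)
    *-split = ℤ.solve-∀
    neg-split : ∀ x y → - x - - y ≡ -1ℤ * (x - y)
    neg-split = ℤ.solve-∀

  ≋-+ : ∀ {m} x y x′ y′ → x ≋ x′ [mod m ] → y ≋ y′ [mod m ] → x + y ≋ x′ + y′ [mod m ]
  ≋-+ x y x′ y′ h k = ∣-lin₂ 1ℤ 1ℤ h k (+-split x y x′ y′)

  ≋-* : ∀ {m} x y x′ y′ → x ≋ x′ [mod m ] → y ≋ y′ [mod m ] → x * y ≋ x′ * y′ [mod m ]
  ≋-* x y x′ y′ h k = ∣-lin₂ y x′ h k (*-split x y x′ y′)

  ≋-neg : ∀ {m} x y → x ≋ y [mod m ] → - x ≋ - y [mod m ]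
  ≋-neg x y h = ∣-lin₁ -1ℤ h (neg-split x y)

  %ℕ-≋ : ∀ x m .{{_ : NonZero m}} → x ≋ + (x %ℕ m) [mod + m ]
  %ℕ-≋ x m = divides (x /ℕ m) (trans (cong (_- + (x %ℕ m)) (a≡a%ℕn+[a/ℕn]*n x m)) (cancel (+ (x %ℕ m)) (x /ℕ m * + m)))

  record Unit (m u : ℤ) : Set where
    constructor inv
    field
      inverse : ℤ
      *-inverse : u * inverse ≋ 1ℤ [mod m ]

  Unit-1 : ∀ {m} → Unit m 1ℤ
  Unit-1 = inv 1ℤ (divides 0ℤ refl)

  Unit-* : ∀ {m u u′} → Unit m u → Unit m u′ → Unit m (u * u′)
  Unit-* {u = u} {u′} (inv v h) (inv v′ h′) = inv (v * v′) (∣-lin₂ (u′ * v′) 1ℤ h h′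
    (ring 4 (λ u u′ v v′ → u :* u′ :* (v :* v′) :- con 1ℤ :=
                           u′ :* v′ :* (u :* v :- con 1ℤ) :+ con 1ℤ :* (u′ :* v′ :- con 1ℤ))
            refl u u′ v v′))

  Unit-neg : ∀ {m u} → Unit m u → Unit m (- u)
  Unit-neg {u = u} (inv v h) = inv (- v) (∣-lin₁ 1ℤ h
    (ring 2 (λ u v → :- u :* :- v :- con 1ℤ := con 1ℤ :* (u :* v :- con 1ℤ)) refl u v))

  Unit-resp : ∀ {m} u w → u ≋ w [mod m ] → Unit m u → Unit m w
  Unit-resp u w k (inv v h) = inv v (∣-lin₂ 1ℤ (- v) h k
    (ring 3 (λ u v w → w :* v :- con 1ℤ := con 1ℤ :* (u :* v :- con 1ℤ) :+ :- v :* (u :- w)) refl u v w))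

  Unit-weaken : ∀ {d m u} → d ∣ m → Unit m u → Unit d u
  Unit-weaken d∣m (inv v h) = inv v (∣-trans d∣m h)

  -- If u v = 1 + m q then v (1 − m q) inverts u modulo m².
  Unit-lift : ∀ {m M u} → M ∣ m * m → Unit m u → Unit M u
  Unit-lift {m} {M} {u} M∣m² (inv v (divides q eq)) =
    inv (v * (1ℤ - q * m)) (∣-lin₁ (- q * q) M∣m² (begin
      u * (v * (1ℤ - q * m)) - 1ℤ
        ≡⟨ ring 4 (λ u v q m → u :* (v :* (con 1ℤ :- q :* m)) :- con 1ℤ :=
                               (u :* v :- con 1ℤ) :* (con 1ℤ :- q :* m) :- q :* m) refl u v q m ⟩
      (u * v - 1ℤ) * (1ℤ - q * m) - q * m
        ≡⟨ cong (λ z → z * (1ℤ - q * m) - q * m) eq ⟩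
      (q * m) * (1ℤ - q * m) - q * m
        ≡⟨ ring 2 (λ q m → q :* m :* (con 1ℤ :- q :* m) :- q :* m := :- q :* q :* (m :* m)) refl q m ⟩
      - q * q * (m * m) ∎))
    where open ≡-Reasoning

  sgn : Sign → ℤ
  sgn Sign.+ = 1ℤ
  sgn Sign.- = -1ℤ

  sgn-square : ∀ ε → sgn ε * sgn ε ≡ 1ℤ
  sgn-square Sign.+ = refl
  sgn-square Sign.- = refl

  signSum : List Sign → ℤ
  signSum []      = 0ℤ
  signSum (ε ∷ s) = sgn ε + signSum s

  -- x ≡ Σ εᵢ uᵢ² modulo m, with units uᵢ and the signs εᵢ listed in s.
  Rep : ℤ → List Sign → ℤ → Set
  Rep m []      x = m ∣ x
  Rep m (ε ∷ s) x = ∃[ u ] Unit m u × Rep m s (x - sgn ε * (u * u))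

  Rep-resp : ∀ {m} s x y → x ≋ y [mod m ] → Rep m s x → Rep m s y
  Rep-resp []      x y h m∣x = ∣-lin₂ 1ℤ -1ℤ m∣x h
    (ring 2 (λ x y → y := con 1ℤ :* x :+ con -1ℤ :* (x :- y)) refl x y)
  Rep-resp (ε ∷ s) x y h (u , unit , r) = u , unit , Rep-resp s _ _
    (∣-lin₁ 1ℤ h (ring 3 (λ x y e → x :- e :- (y :- e) := con 1ℤ :* (x :- y)) refl x y (sgn ε * (u * u)))) r

  Rep-weaken : ∀ {d m} s x → d ∣ m → Rep m s x → Rep d s x
  Rep-weaken []      x d∣m m∣x            = ∣-trans d∣m m∣x
  Rep-weaken (ε ∷ s) x d∣m (u , unit , r) = u , Unit-weaken d∣m unit , Rep-weaken s _ d∣m r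

  Rep-ones : ∀ {m} s x → x ≋ signSum s [mod m ] → Rep m s x
  Rep-ones []      x h = ∣-lin₁ 1ℤ h (ring 1 (λ x → x := con 1ℤ :* (x :- con 0ℤ)) refl x)
  Rep-ones (ε ∷ s) x h = 1ℤ , Unit-1 , Rep-ones s _ (∣-lin₁ 1ℤ h
    (ring 3 (λ x e z → x :- e :* con 1ℤ :- z := con 1ℤ :* (x :- (e :+ z))) refl x (sgn ε) (signSum s)))

  Rep-signSum : ∀ {m} → (∀ {u} → Unit m u → u * u ≋ 1ℤ [mod m ]) →
                ∀ s x → Rep m s x → x ≋ signSum s [mod m ]
  Rep-signSum one []      x m∣x = ∣-lin₁ 1ℤ m∣x (ring 1 (λ x → x :- con 0ℤ := con 1ℤ :* x) refl x)
  Rep-signSum one (ε ∷ s) x (u , unit , r) = ∣-lin₂ (sgn ε) 1ℤ (one unit) (Rep-signSum one s _ r)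
    (ring 4 (λ x w e z → x :- (e :+ z) := e :* (w :- con 1ℤ) :+ con 1ℤ :* (x :- e :* w :- z))
            refl x (u * u) (sgn ε) (signSum s))

  Universal : ℤ → List Sign → Set
  Universal m s = ∀ x → Rep m s x

  Universal-∷ : ∀ {m} ε s → Universal m s → Universal m (ε ∷ s)
  Universal-∷ ε s U x = 1ℤ , Unit-1 , U _

  -- Chinese remainder theorem

  module _ (m n a b : ℤ) (bezout : a * m + b * n ≡ 1ℤ) where

    open ≡-Reasoning

    crt : ∀ x y → ∃[ z ] z ≋ x [mod m ] × z ≋ y [mod n ]
    crt x y = x * (b * n) + y * (a * m) ,
      divides ((y - x) * a) (begin
        x * (b * n) + y * (a * m) - x
          ≡⟨ ring 6 (λ x y a b m n → x :* (b :* n) :+ y :* (a :* m) :- x :=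
                                     (y :- x) :* a :* m :+ x :* (a :* m :+ b :* n :- con 1ℤ)) refl x y a b m n ⟩
        (y - x) * a * m + x * (a * m + b * n - 1ℤ)
          ≡⟨ cong (λ z → (y - x) * a * m + x * (z - 1ℤ)) bezout ⟩
        (y - x) * a * m + x * 0ℤ
          ≡⟨ ring 2 (λ x z → z :+ x :* con 0ℤ := z) refl x ((y - x) * a * m) ⟩
        (y - x) * a * m ∎) ,
      divides ((x - y) * b) (begin
        x * (b * n) + y * (a * m) - y
          ≡⟨ ring 6 (λ x y a b m n → x :* (b :* n) :+ y :* (a :* m) :- y :=
                                     (x :- y) :* b :* n :+ y :* (a :* m :+ b :* n :- con 1ℤ)) refl x y a b m n ⟩
        (x - y) * b * n + y * (a * m + b * n - 1ℤ)
          ≡⟨ cong (λ z → (x - y) * b * n + y * (z - 1ℤ)) bezout ⟩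
        (x - y) * b * n + y * 0ℤ
          ≡⟨ ring 2 (λ y z → z :+ y :* con 0ℤ := z) refl y ((x - y) * b * n) ⟩
        (x - y) * b * n ∎)

    ∣-crt : ∀ {x} → m ∣ x → n ∣ x → m * n ∣ x
    ∣-crt {x} (divides q x≡qm) (divides r x≡rn) = divides (a * r + b * q) (begin
      x                                        ≡⟨ ℤ.*-identityˡ x ⟨
      1ℤ * x                                   ≡⟨ cong (_* x) bezout ⟨
      (a * m + b * n) * x                      ≡⟨ ring 5 (λ a b m n x → (a :* m :+ b :* n) :* x := a :* m :* x :+ b :* n :* x) refl a b m n x ⟩
      a * m * x + b * n * x                    ≡⟨ cong₂ (λ y z → a * m * y + b * n * z) x≡rn x≡qm ⟩
      a * m * (r * n) + b * n * (q * m)        ≡⟨ ring 6 (λ a b m n q r → a :* m :* (r :* n) :+ b :* n :* (q :* m) := (a :* r :+ b :* q) :* (m :* n)) refl a b m n q r ⟩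
      (a * r + b * q) * (m * n)                ∎)

    Unit-crt : ∀ {u} → Unit m u → Unit n u → Unit (m * n) u
    Unit-crt {u} (inv v h) (inv w k) = let z , z≋v , z≋w = crt v w in
      inv z (∣-crt (∣-lin₂ 1ℤ u h z≋v (split u v z)) (∣-lin₂ 1ℤ u k z≋w (split u w z)))
      where
      split : ∀ u v z → u * z - 1ℤ ≡ 1ℤ * (u * v - 1ℤ) + u * (z - v)
      split = ring 3 (λ u v z → u :* z :- con 1ℤ := con 1ℤ :* (u :* v :- con 1ℤ) :+ u :* (z :- v)) refl

    Rep-crt : ∀ s x → Rep m s x → Rep n s x → Rep (m * n) s x
    Rep-crt []      x h k = ∣-crt h k
    Rep-crt (ε ∷ s) x (u , uu , r) (v , uv , t) =
      let w , w≋u , w≋v = crt u v in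
      w , Unit-crt (Unit-resp u w (≋-sym w u w≋u) uu) (Unit-resp v w (≋-sym w v w≋v) uv) ,
      Rep-crt s _ (Rep-resp s _ _ (shift (sgn ε) u w w≋u) r)
                (Rep-resp s _ _ (shift (sgn ε) v w w≋v) t)
      where
      shift : ∀ {m} e u w → w ≋ u [mod m ] → x - e * (u * u) ≋ x - e * (w * w) [mod m ]
      shift e u w h = ∣-lin₁ (e * (w + u)) h
        (ring 4 (λ x e u w → x :- e :* (u :* u) :- (x :- e :* (w :* w)) := e :* (w :+ u) :* (w :- u)) refl x e u w)

  -- Hensel lifting

  -- Hensel's lemma for one square: an error that is a multiple of `m` can be absorbed by moving a
  -- single unit. As a property of the pair it lets odd primes and 2, whose corrections differ in
  -- size, share `Rep-lift`.
  Adjustable : ℤ → ℤ → Set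
  Adjustable m r = ∀ u → Unit m u → ∀ c → ∃[ w ] Unit (m * r) w × w * w ≋ u * u + c * m [mod m * r ]

  module _ (m r : ℤ) (r∣m : r ∣ m) where

    open ≡-Reasoning

    private
      Unit-step : ∀ {u} → Unit m u → Unit (m * r) u
      Unit-step = Unit-lift (*-monoʳ-∣ m r∣m)

    -- Only the head of a list is adjusted in `Rep-lift`. Here all units are kept, and their total
    -- error modulo `m * r`, some multiple of `m`, is handed over. This is why only nonempty lists
    -- are lifted.
    Rep-lift-tail : ∀ s x → Rep m s x → ∃[ c ] Rep (m * r) s (x + c * m)
    Rep-lift-tail [] .(q * m) (divides q refl) = - q , divides 0ℤ
      (ring 3 (λ q m r → q :* m :+ :- q :* m := con 0ℤ :* (m :* r)) refl q m r)
    Rep-lift-tail (ε ∷ s) x (u , unit , h) = let c , h′ = Rep-lift-tail s _ h in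
      c , u , Unit-step unit , Rep-resp s _ _ (≋-reflexive (ring 4 (λ x e c m →
        x :- e :+ c :* m := x :+ c :* m :- e) refl x (sgn ε * (u * u)) c m)) h′

    Rep-lift : Adjustable m r → ∀ ε s x → Rep m (ε ∷ s) x → Rep (m * r) (ε ∷ s) x
    Rep-lift adj ε s x (u , unit , h) =
      let c , h′          = Rep-lift-tail s _ h
          -- Passing from u to w changes ε u² by ε · (- ε c m) = - c m, because ε² = 1.
          w , unit′ , w²≋ = adj u unit (- (sgn ε * c))
      in w , unit′ , Rep-resp s _ _ (shift c w (sgn ε) (sgn-square ε) w²≋) h′
      where
      shift : ∀ c w e → e * e ≡ 1ℤ → w * w ≋ u * u + - (e * c) * m [mod m * r ] →
              x - e * (u * u) + c * m ≋ x - e * (w * w) [mod m * r ]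
      shift c w e e² k = ∣-lin₁ e k (begin
        x - e * (u * u) + c * m - (x - e * (w * w))
          ≡⟨ ring 6 (λ x e u w c m → x :- e :* (u :* u) :+ c :* m :- (x :- e :* (w :* w)) :=
                                     e :* (w :* w :- u :* u) :+ con 1ℤ :* (c :* m)) refl x e u w c m ⟩
        e * (w * w - u * u) + 1ℤ * (c * m)
          ≡⟨ cong (λ z → e * (w * w - u * u) + z * (c * m)) e² ⟨
        e * (w * w - u * u) + e * e * (c * m)
          ≡⟨ ring 5 (λ e u w c m → e :* (w :* w :- u :* u) :+ e :* e :* (c :* m) :=
                                   e :* (w :* w :- (u :* u :+ :- (e :* c) :* m))) refl e u w c m ⟩
        e * (w * w - (u * u + - (e * c) * m)) ∎)

    -- (u + t m)² = u² + 2 u t m modulo m r, so take t = c / 2u.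
    adjustable-odd : Unit r (+ 2) → Adjustable m r
    adjustable-odd (inv j 2j≋1) u unit@(inv v uv≋1) c =
      u + t * m ,
      Unit-step (Unit-resp u (u + t * m) (divides (- t) (ring 3 (λ u t m → u :- (u :+ t :* m) := :- t :* m) refl u t m)) unit) ,
      congr r∣m 2j≋1 (∣-trans r∣m uv≋1)
      where
      t : ℤ
      t = j * v * c
      congr : r ∣ m → + 2 * j ≋ 1ℤ [mod r ] → u * v ≋ 1ℤ [mod r ] →
              (u + t * m) * (u + t * m) ≋ u * u + c * m [mod m * r ]
      congr (divides a m≡) (divides b 2j≡) (divides d uv≡) =
        divides (d * c + (b + b * d * r) * c + t * t * a) (begin
          (u + t * m) * (u + t * m) - (u * u + c * m)
            ≡⟨ ring 5 (λ u v j c m → let t = j :* v :* c ; y = con (+ 2) :* j :- con 1ℤ ; z = u :* v :- con 1ℤ in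
                 (u :+ t :* m) :* (u :+ t :* m) :- (u :* u :+ c :* m) :=
                 m :* ((y :* z :+ y :+ z) :* c :+ t :* t :* m)) refl u v j c m ⟩
          m * (((+ 2 * j - 1ℤ) * (u * v - 1ℤ) + (+ 2 * j - 1ℤ) + (u * v - 1ℤ)) * c + t * t * m)
            ≡⟨ cong₂ (λ y z → m * ((y * z + y + z) * c + t * t * m)) 2j≡ uv≡ ⟩
          m * ((b * r * (d * r) + b * r + d * r) * c + t * t * m)
            ≡⟨ cong (λ z → m * ((b * r * (d * r) + b * r + d * r) * c + t * t * z)) m≡ ⟩
          m * ((b * r * (d * r) + b * r + d * r) * c + t * t * (a * r))
            ≡⟨ ring 7 (λ m a b r d c t →
                 m :* ((b :* r :* (d :* r) :+ b :* r :+ d :* r) :* c :+ t :* t :* (a :* r)) :=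
                 (d :* c :+ (b :+ b :* d :* r) :* c :+ t :* t :* a) :* (m :* r)) refl m a b r d c t ⟩
          (d * c + (b + b * d * r) * c + t * t * a) * (m * r) ∎)

  -- The derivative 2u is not invertible at 2, so the correction is a multiple of m / 2. With m =
  -- 8e, (u + t m / 2)² = u² + u t m + 16 e² t²; the last term vanishes modulo 2m, and t = c / u
  -- works.
  adjustable-2 : ∀ e → Adjustable (e * + 8) (+ 2)
  adjustable-2 e u unit@(inv v uv≋1) c =
    -- w agrees with u only modulo 4e, but 2m = 16e divides (4e)², so `Unit-lift` applies from
    -- there.
    w , Unit-lift {e * + 4} (divides e (ring 1 (λ e → e :* con (+ 4) :* (e :* con (+ 4)) := e :* (e :* con (+ 8) :* con (+ 2))) refl e))
          (Unit-resp u w (divides (- t) (ring 3 (λ u t e → u :- (u :+ t :* (e :* con (+ 4))) := :- t :* (e :* con (+ 4))) refl u t e))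
            (Unit-weaken {e * + 4} {e * + 8} (divides (+ 2) (ring 1 (λ e → e :* con (+ 8) := con (+ 2) :* (e :* con (+ 4))) refl e)) unit)) ,
    congr uv≋1
    where
    open ≡-Reasoning
    t w : ℤ
    t = v * c
    w = u + t * (e * + 4)
    congr : u * v ≋ 1ℤ [mod e * + 8 ] → w * w ≋ u * u + c * (e * + 8) [mod e * + 8 * + 2 ]
    congr (divides q uv≡) = divides (q * c * e * + 4 + t * t * e) (begin
      w * w - (u * u + c * (e * + 8))
        ≡⟨ ring 4 (λ u v c e → let t = v :* c ; w = u :+ t :* (e :* con (+ 4)) in
             w :* w :- (u :* u :+ c :* (e :* con (+ 8))) :=
             (u :* v :- con 1ℤ) :* c :* e :* con (+ 8) :+ t :* t :* e :* e :* con (+ 16)) refl u v c e ⟩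
      (u * v - 1ℤ) * c * e * + 8 + t * t * e * e * + 16
        ≡⟨ cong (λ z → z * c * e * + 8 + t * t * e * e * + 16) uv≡ ⟩
      q * (e * + 8) * c * e * + 8 + t * t * e * e * + 16
        ≡⟨ ring 4 (λ q e t c → q :* (e :* con (+ 8)) :* c :* e :* con (+ 8) :+ t :* t :* e :* e :* con (+ 16) :=
             (q :* c :* e :* con (+ 4) :+ t :* t :* e) :* (e :* con (+ 8) :* con (+ 2))) refl q e t c ⟩
      (q * c * e * + 4 + t * t * e) * (e * + 8 * + 2) ∎)

  -- From gcd (n, 24) and the primes p ≥ 5 to the modulus n

  pos-∣ : ∀ {m n} → m ℕ.∣ n → + m ∣ + n
  pos-∣ = ∣ᵤ⇒∣

  coprime-bezout : ∀ {m n} → Coprime m n → ∃[ a ] ∃[ b ] a * + m + b * + n ≡ 1ℤ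
  coprime-bezout {m} {n} c with Coprime.coprime-Bézout c
  ... | Bézout.+- x y eq = + x , - + y , (begin
    + x * + m + - + y * + n          ≡⟨ cong (_+ - + y * + n) (ℤ.pos-* x m) ⟨
    + (x ℕ.* m) + - + y * + n        ≡⟨ cong (λ z → + z + - + y * + n) eq ⟨
    1ℤ + + (y ℕ.* n) + - + y * + n   ≡⟨ cong (λ z → 1ℤ + z + - + y * + n) (ℤ.pos-* y n) ⟩
    1ℤ + + y * + n + - + y * + n     ≡⟨ ring 2 (λ y n → con 1ℤ :+ y :* n :+ :- y :* n := con 1ℤ) refl (+ y) (+ n) ⟩
    1ℤ ∎)
    where open ≡-Reasoning
  ... | Bézout.-+ x y eq = - + x , + y , (begin
    - + x * + m + + y * + n          ≡⟨ cong (_+_ (- + x * + m)) (ℤ.pos-* y n) ⟨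
    - + x * + m + + (y ℕ.* n)        ≡⟨ cong (λ z → - + x * + m + + z) eq ⟨
    - + x * + m + (1ℤ + + (x ℕ.* m)) ≡⟨ cong (λ z → - + x * + m + (1ℤ + z)) (ℤ.pos-* x m) ⟩
    - + x * + m + (1ℤ + + x * + m)   ≡⟨ ring 2 (λ x m → :- x :* m :+ (con 1ℤ :+ x :* m) := con 1ℤ) refl (+ x) (+ m) ⟩
    1ℤ ∎)
    where open ≡-Reasoning

  prime∤⇒coprime : ∀ {p k} → Prime p → ¬ p ℕ.∣ k → Coprime p k
  prime∤⇒coprime pr p∤k (i∣p , i∣k) with prime⇒irreducible pr i∣p
  ... | inj₁ i≡1  = i≡1
  ... | inj₂ refl = contradiction i∣k p∤k

  coprime⇒Unit : ∀ {m k} → Coprime m k → Unit (+ m) (+ k)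
  coprime⇒Unit {m} {k} c = let a , b , eq = coprime-bezout c in inv b (divides (- a) (begin
    + k * b - 1ℤ                  ≡⟨ cong (_-_ (+ k * b)) eq ⟨
    + k * b - (a * + m + b * + k) ≡⟨ ring 4 (λ k b a m → k :* b :- (a :* m :+ b :* k) := :- a :* m) refl (+ k) b a (+ m) ⟩
    - a * + m ∎))
    where open ≡-Reasoning

  prime∤⇒Unit : ∀ {p} u → Prime p → ¬ + p ∣ u → Unit (+ p) u
  prime∤⇒Unit (+ k)    pr p∤u = coprime⇒Unit (prime∤⇒coprime pr (p∤u ∘ ∣ᵤ⇒∣))
  prime∤⇒Unit -[1+ k ] pr p∤u = Unit-neg (coprime⇒Unit {k = suc k} (prime∤⇒coprime pr (p∤u ∘ ∣ᵤ⇒∣)))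

  ∤-small : ∀ {p k} .{{_ : NonZero k}} → k ℕ.< p → ¬ + p ∣ + k
  ∤-small k<p p∣k = ℕ.<⇒≱ k<p (ℕ.∣⇒≤ (∣⇒∣ᵤ p∣k))

  -- How a representation modulo d extends to another factor p.
  data Local (d : ℕ) (s : List Sign) (x : ℤ) (p : ℕ) : Set where
    at-2       : p ≡ 2 → 8 ℕ.∣ d → Local d s x p
    ramified   : 2 ℕ.< p → p ℕ.∣ d → Local d s x p
    unramified : 2 ℕ.< p → Rep (+ p) s x → Local d s x p

  module _ (d : ℕ) (ε : Sign) (s : List Sign) (x : ℤ) (rep-d : Rep (+ d) (ε ∷ s) x) where

    rep-lift-odd : ∀ {m p} → Prime p → 2 ℕ.< p → p ℕ.∣ m → Rep (+ m) (ε ∷ s) x → Rep (+ m * + p) (ε ∷ s) x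
    rep-lift-odd {m} {p} pr 2<p p∣m =
      Rep-lift (+ m) (+ p) (pos-∣ p∣m)
        (adjustable-odd (+ m) (+ p) (pos-∣ p∣m) (prime∤⇒Unit (+ 2) pr (∤-small 2<p))) ε s x

    -- Prime factors are multiplied onto `d` one at a time. A prime already present in the modulus
    -- calls for Hensel lifting, a new one for the Chinese remainder theorem.
    rep-product : ∀ ps → All Prime ps → All (Local d (ε ∷ s) x) ps → Rep (+ (product ps ℕ.* d)) (ε ∷ s) x
    rep-product [] [] [] = subst (λ z → Rep (+ z) (ε ∷ s) x) (sym (ℕ.*-identityˡ d)) rep-d
    rep-product (p ∷ ps) (pr ∷ primes) (local ∷ locals) =
      subst (λ z → Rep z (ε ∷ s) x) *-shuffle (step local)
      where
      m : ℕ
      m = product ps ℕ.* d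
      ih : Rep (+ m) (ε ∷ s) x
      ih = rep-product ps primes locals
      *-shuffle : + m * + p ≡ + (p ℕ.* product ps ℕ.* d)
      *-shuffle = trans (sym (ℤ.pos-* m p)) (cong +_ (trans (ℕ.*-comm m p) (sym (ℕ.*-assoc p _ d))))
      d∣m : d ℕ.∣ m
      d∣m = ℕ.n∣m*n (product ps)
      step : Local d (ε ∷ s) x p → Rep (+ m * + p) (ε ∷ s) x
      step (at-2 refl 8∣d) with pos-∣ (ℕ.∣-trans 8∣d d∣m)
      ... | 8∣m@(divides e eq) = Rep-lift (+ m) (+ 2) (∣-trans (divides (+ 4) refl) 8∣m)
                                   (subst (λ z → Adjustable z (+ 2)) (sym eq) (adjustable-2 e)) ε s x ih
      step (ramified 2<p p∣d) = rep-lift-odd pr 2<p (ℕ.∣-trans p∣d d∣m) ih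
      -- A repeated prime can be new only at its innermost occurrence in the list; from then on it
      -- is lifted.
      step (unramified 2<p rep-p) with p ℕ.∣? m
      ... | yes p∣m = rep-lift-odd pr 2<p p∣m ih
      ... | no  p∤m = let a , b , eq = coprime-bezout (Coprime.sym (prime∤⇒coprime pr p∤m)) in
                      Rep-crt (+ m) (+ p) a b eq (ε ∷ s) x ih rep-p

  prime-cases : ∀ {p} → Prime p → p ≡ 2 ⊎ p ≡ 3 ⊎ 5 ℕ.≤ p
  prime-cases {0} pr = contradiction pr ¬prime[0]
  prime-cases {1} pr = contradiction pr ¬prime[1]
  prime-cases {2} pr = inj₁ refl
  prime-cases {3} pr = inj₂ (inj₁ refl)
  prime-cases {4} pr = contradiction pr (composite⇒¬prime composite[4])
  prime-cases {suc (suc (suc (suc (suc k))))} pr = inj₂ (inj₂ (ℕ.m≤m+n 5 k))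

  -- For d = gcd (n, 24), a prime dividing n / d cannot enlarge d to a further divisor of 24. So 2 ∣
  -- n / d forces 8 ∣ d, the starting point of lifting at 2, and 3 ∣ n / d forces 3 ∣ d.
  divisor-24 : ∀ {d} → d ℕ.≤ 24 → d ℕ.∣ 24 →
               (8 ℕ.∣ d ⊎ 2 ℕ.* d ℕ.∣ 24) × (3 ℕ.∣ d ⊎ 3 ℕ.* d ℕ.∣ 24)
  divisor-24 {d} d≤24 = toWitness {a? = ℕ.allUpTo? (λ d → d ℕ.∣? 24 →-dec
    ((8 ℕ.∣? d ⊎-dec 2 ℕ.* d ℕ.∣? 24) ×-dec (3 ℕ.∣? d ⊎-dec 3 ℕ.* d ℕ.∣? 24))) 25} _ (ℕ.s≤s d≤24)

  -- Modulo gcd (n, 24) all units are taken to be 1, which leaves a condition on the sum of the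
  -- signs only. The remaining prime factors of n are lifted or, when new, glued from the given
  -- representations.
  local-global : ∀ n .{{_ : NonZero n}} ε s x → x ≋ signSum (ε ∷ s) [mod + gcd n 24 ] →
                 (∀ {p} → Prime p → 5 ℕ.≤ p → p ℕ.∣ n → Rep (+ p) (ε ∷ s) x) →
                 Rep (+ n) (ε ∷ s) x
  local-global n ε s x x≋ reps with gcd[m,n]∣m n 24
  ... | ℕ.divides q n≡qd = subst (λ z → Rep (+ z) (ε ∷ s) x) (sym (trans n≡qd (cong (ℕ._* d) isFactorisation)))
          (rep-product d ε s x (Rep-ones (ε ∷ s) x x≋) factors factorsPrime
            (All.tabulate λ p∈ → local (All.lookup factorsPrime p∈)
               (subst (_ ℕ.∣_) (sym isFactorisation) (∈⇒∣product p∈))))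
    where
    d : ℕ
    d = gcd n 24
    d∣24 : d ℕ.∣ 24
    d∣24 = gcd[m,n]∣n n 24
    d∣24-facts : (8 ℕ.∣ d ⊎ 2 ℕ.* d ℕ.∣ 24) × (3 ℕ.∣ d ⊎ 3 ℕ.* d ℕ.∣ 24)
    d∣24-facts = divisor-24 (ℕ.∣⇒≤ d∣24) d∣24
    instance
      d≢0 : NonZero d
      d≢0 = ℕ.≢-nonZero λ d≡0 →
        ℕ.≢-nonZero⁻¹ n (trans n≡qd (trans (cong (q ℕ.*_) d≡0) (ℕ.*-zeroʳ q)))
      q≢0 : NonZero q
      q≢0 = ℕ.≢-nonZero λ q≡0 → ℕ.≢-nonZero⁻¹ n (trans n≡qd (cong (ℕ._* d) q≡0))
    open PrimeFactorisation (factorise q)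
    multiple : ∀ {p} → p ℕ.∣ q → p ℕ.* d ℕ.∣ n
    multiple {p} p∣q = subst (p ℕ.* d ℕ.∣_) (sym n≡qd) (ℕ.*-monoˡ-∣ d p∣q)
    p*d∤24 : ∀ {p} → 2 ℕ.≤ p → p ℕ.∣ q → ¬ p ℕ.* d ℕ.∣ 24
    p*d∤24 {p} 2≤p p∣q pd∣24 = ℕ.<⇒≱ (subst (d ℕ.<_) (ℕ.*-comm d p) (ℕ.m<m*n d p 2≤p)) (ℕ.∣⇒≤ {d} {p ℕ.* d} (gcd-greatest {n} {24} (multiple p∣q) pd∣24))
    local : ∀ {p} → Prime p → p ℕ.∣ q → Local d (ε ∷ s) x p
    local pr p∣q with prime-cases pr
    ... | inj₁ refl = at-2 refl (fromInj₁ (λ 2d∣24 → contradiction 2d∣24 (p*d∤24 ℕ.≤-refl p∣q)) (proj₁ d∣24-facts))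
    ... | inj₂ (inj₁ refl) = ramified ℕ.≤-refl (fromInj₁ (λ 3d∣24 → contradiction 3d∣24 (p*d∤24 (ℕ.m≤m+n 2 1) p∣q)) (proj₂ d∣24-facts))
    ... | inj₂ (inj₂ p≥5)  = unramified (ℕ.≤-trans (ℕ.m≤m+n 3 2) p≥5)
                               (reps pr p≥5 (subst (_ ℕ.∣_) (sym n≡qd) (ℕ.∣m⇒∣m*n d p∣q)))

  -- Pigeonhole principle and counting modulo 2

  injective⇒surjective : ∀ {n} (f : Fin n → Fin n) → Injective _≡_ _≡_ f → ∀ j → ∃[ i ] f i ≡ j
  injective⇒surjective {suc n} f inj j with any? (λ i → f i Fin.≟ j)
  ... | yes p = p
  ... | no ¬p = contradiction (injective⇒≤ {f = g} g-injective) ℕ.1+n≰n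
    where
    j≢f : ∀ i → j ≢ f i
    j≢f i j≡fi = ¬p (i , sym j≡fi)
    g : Fin (suc n) → Fin n
    g i = punchOut (j≢f i)
    g-injective : Injective _≡_ _≡_ g
    g-injective {i} {k} eq = inj (punchOut-injective (j≢f i) (j≢f k) eq)

  sum-false : ∀ {n} (f : Fin n → Bool) → (∀ i → f i ≡ false) → sum f ≡ false
  sum-false {zero}  f f≡0 = refl
  sum-false {suc n} f f≡0 rewrite f≡0 zero = sum-false (f ∘ suc) (f≡0 ∘ suc)

  sum-single : ∀ {n} (f : Fin n → Bool) j → f j ≡ true → (∀ i → f i ≡ true → i ≡ j) → sum f ≡ true
  sum-single f zero fj≡1 unique rewrite fj≡1 = cong not (sum-false (f ∘ suc) rest)
    where
    rest : ∀ i → f (suc i) ≡ false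
    rest i with f (suc i) in eq
    ... | false = refl
    ... | true with () ← unique (suc i) eq
  sum-single f (suc j) fj≡1 unique with f zero in eq
  ... | true with () ← unique zero eq
  ... | false = sum-single (f ∘ suc) j fj≡1 (λ i → Fin.suc-injective ∘ unique (suc i))

  -- Sums over `xor` are counts modulo 2, so the entries at (i , j) and (j , i) cancel off the
  -- diagonal.
  sum-symmetric : ∀ {n} (M : Fin n → Fin n → Bool) → (∀ i j → M i j ≡ M j i) →
                  sum (λ i → sum (M i)) ≡ sum (λ i → M i i)
  sum-symmetric {zero}  M M-sym = refl
  sum-symmetric {suc n} M M-sym = begin
    (M zero zero xor row) xor sum (λ i → M (suc i) zero xor sum (M (suc i) ∘ suc))
      ≡⟨ cong ((M zero zero xor row) xor_)
           (∑-distrib-+ (λ i → M (suc i) zero) (λ i → sum (M (suc i) ∘ suc))) ⟩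
    (M zero zero xor row) xor (sum (λ i → M (suc i) zero) xor sum (λ i → sum (M (suc i) ∘ suc)))
      ≡⟨ cong₂ (λ a b → (M zero zero xor row) xor (a xor b))
           (sum-cong-≗ (λ i → M-sym (suc i) zero))
           (sum-symmetric (λ i j → M (suc i) (suc j)) (λ i j → M-sym (suc i) (suc j))) ⟩
    (M zero zero xor row) xor (row xor trace)
      ≡⟨ xor-cancel (M zero zero) row trace ⟩
    M zero zero xor trace ∎
    where
    open ≡-Reasoning
    row trace : Bool
    row = sum (M zero ∘ suc)
    trace = sum (λ i → M (suc i) (suc i))
    xor-cancel : ∀ a b c → (a xor b) xor (b xor c) ≡ a xor c
    xor-cancel a b c = begin
      (a xor b) xor (b xor c) ≡⟨ xor-assoc a b (b xor c) ⟩
      a xor (b xor (b xor c)) ≡⟨ cong (a xor_) (xor-assoc b b c) ⟨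
      a xor ((b xor b) xor c) ≡⟨ cong (λ z → a xor (z xor c)) (xor-same b) ⟩
      a xor c                 ∎

  -- Written as a sum of ones so that it is literally the total of a matrix with one odd entry sum
  -- per row, as in `parity-half`.
  parity : ℕ → Bool
  parity n = sum {n} (λ _ → true)

  parity-double : ∀ k → parity (k ℕ.+ k) ≡ false
  parity-double zero    = refl
  parity-double (suc k) = begin
    not (parity (k ℕ.+ suc k)) ≡⟨ cong (not ∘ parity) (ℕ.+-suc k k) ⟩
    not (not (parity (k ℕ.+ k))) ≡⟨ not-involutive _ ⟩
    parity (k ℕ.+ k) ≡⟨ parity-double k ⟩
    false ∎
    where open ≡-Reasoning

  double-cases : ∀ n → (∃[ k ] n ≡ k ℕ.+ k) ⊎ (∃[ k ] n ≡ suc (k ℕ.+ k))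
  double-cases zero = inj₁ (0 , refl)
  double-cases (suc n) with double-cases n
  ... | inj₁ (k , refl) = inj₂ (k , refl)
  ... | inj₂ (k , refl) = inj₁ (suc k , cong suc (sym (ℕ.+-suc k k)))

  1+4k≡ : ∀ k → suc (k ℕ.+ k ℕ.+ (k ℕ.+ k)) ≡ 1 ℕ.+ k ℕ.* 4
  1+4k≡ = solve-∀

  3+4k≡ : ∀ k → suc (suc (k ℕ.+ k) ℕ.+ suc (k ℕ.+ k)) ≡ 3 ℕ.+ k ℕ.* 4
  3+4k≡ = solve-∀

  -- Prime fields: squares up to sign and the square root of -1

  private
    identity₁ : ∀ i → 1ℤ ≡ 1ℤ * (i * i + 1ℤ) + - i * i
    identity₁ = ℤ.solve-∀

    identity₂ : ∀ a b → b + 1ℤ ≡ 1ℤ * (a + 1ℤ) + -1ℤ * (a - b)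
    identity₂ = ℤ.solve-∀

    identity₃ : ∀ a b c → (a - b) * (a + b) ≡ 1ℤ * (a * a - c) + -1ℤ * (b * b - c)
    identity₃ = ℤ.solve-∀

    identity₄ : ∀ a b v → a * v * (a * v) + 1ℤ ≡ v * v * (a * a + b * b) + - (b * v + 1ℤ) * (b * v - 1ℤ)
    identity₄ = ℤ.solve-∀

    identity₅ : ∀ a v → 1ℤ ≡ a * v + -1ℤ * (a * v - 1ℤ)
    identity₅ = ℤ.solve-∀

    identity₆ : ∀ a b v → a * b * (a * b) - 1ℤ ≡ - (a * a) * (v * v - b * b) + (a * v + 1ℤ) * (a * v - 1ℤ)
    identity₆ = ℤ.solve-∀

    identity₇ : ∀ i j k v → k * k - j * j ≡
      1ℤ * (v * v * (i * k * (i * k) - 1ℤ) + - (k * k * (i * v + 1ℤ)) * (i * v - 1ℤ)) + 1ℤ * (v * v - j * j)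
    identity₇ = ℤ.solve-∀

    identity₈ : ∀ a → a * a - 1ℤ ≡ (a - 1ℤ) * (a + 1ℤ)
    identity₈ = ℤ.solve-∀

    identity₉ : ∀ a → + 2 ≡ 1ℤ * (a + 1ℤ) + -1ℤ * (a - 1ℤ)
    identity₉ = ℤ.solve-∀

    identity₁₀ : ∀ a → a - 1ℤ ≡ -1ℤ * (1ℤ - a)
    identity₁₀ = ℤ.solve-∀

    identity₁₁ : ∀ a b → a - b ≡ 1ℤ * (a - 1ℤ) + 1ℤ * (1ℤ - b)
    identity₁₁ = ℤ.solve-∀

    identity₁₂ : ∀ a b → a - b ≡ 1ℤ * (a + 1ℤ) + -1ℤ * (b + 1ℤ)
    identity₁₂ = ℤ.solve-∀

    factor₁ : ∀ a b → a * a - b * b ≡ (a - b) * (a + b)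
    factor₁ = ℤ.solve-∀

    factor₂ : ∀ a b → a * a - b * b ≡ (a + b) * (a - b)
    factor₂ = ℤ.solve-∀

    shuffle : ∀ k y j → k + y + j ≡ y + (j + k)
    shuffle = ℤ.solve-∀

    collect : ∀ y P → y * P + P ≡ (y + 1ℤ) * P
    collect = ℤ.solve-∀

  module PrimeField {p : ℕ} (p-prime : Prime p) where

    P : ℤ
    P = + p

    euclid : ∀ a b → P ∣ a * b → P ∣ a ⊎ P ∣ b
    euclid a b P∣ab with euclidsLemma (abs a) (abs b) p-prime (subst (p ℕ.∣_) (ℤ.abs-* a b) (∣⇒∣ᵤ P∣ab))
    ... | inj₁ h = inj₁ (∣ᵤ⇒∣ h)
    ... | inj₂ h = inj₂ (∣ᵤ⇒∣ h)

    P∤1 : ¬ P ∣ 1ℤ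
    P∤1 P∣1 = ¬prime[1] (subst Prime (ℕ.∣1⇒≡1 (∣⇒∣ᵤ P∣1)) p-prime)

    square≋⇒±≋ : ∀ x y → P ∣ x * x - y * y → P ∣ x - y ⊎ P ∣ x + y
    square≋⇒±≋ x y h = euclid (x - y) (x + y) (subst (P ∣_) (factor₁ x y) h)

    ≋⇒square≋ : ∀ x y → P ∣ x - y → P ∣ x * x - y * y
    ≋⇒square≋ x y h = ∣-lin₁ (x + y) h (factor₂ x y)

    ≋-⇒square≋ : ∀ x y → P ∣ x + y → P ∣ x * x - y * y
    ≋-⇒square≋ x y h = ∣-lin₁ (x - y) h (factor₁ x y)

    ∤⇒Unit : ∀ {u} → ¬ P ∣ u → Unit P u
    ∤⇒Unit {u} = prime∤⇒Unit u p-prime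

    Sqrt-1 : Set
    Sqrt-1 = ∃[ i ] P ∣ i * i + 1ℤ

  half-positive : ∀ {p} h → Prime p → p ≡ suc (h ℕ.+ h) → 0 ℕ.< h
  half-positive zero    p-prime refl = contradiction p-prime ¬prime[1]
  half-positive (suc h) p-prime p≡   = ℕ.s≤s ℕ.z≤n

  -- A system e of representatives of (ℤ/p)ˣ / ±1; x ≡ ± y is expressed as x² ≡ y².
  module HalfSystem {p : ℕ} (p-prime : Prime p) (2<p : 2 ℕ.< p) {h : ℕ} (e : Fin h → ℤ)
    (e-∤ : ∀ i → ¬ + p ∣ e i)
    (e-injective : ∀ i j → + p ∣ e i * e i - e j * e j → i ≡ j)
    (half : ∀ x → ¬ + p ∣ x → ∃[ j ] + p ∣ x * x - e j * e j)
    where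

    open PrimeField p-prime

    e-unit : ∀ i → Unit P (e i)
    e-unit i = ∤⇒Unit (e-∤ i)

    -- A square root of -1 is nonzero, hence agrees up to sign with a representative, and a finite
    -- search decides.
    sqrt-1? : Dec Sqrt-1
    sqrt-1? = map′ (λ (j , div) → e j , div) from (any? (λ j → P ∣? e j * e j + 1ℤ))
      where
      from : Sqrt-1 → ∃[ j ] P ∣ e j * e j + 1ℤ
      from (i , P∣) =
        let j , i²≋j² = half i (λ P∣i → P∤1 (∣-lin₂ 1ℤ (- i) P∣ P∣i (identity₁ i)))
        in j , ∣-lin₂ 1ℤ -1ℤ P∣ i²≋j² (identity₂ (i * i) (e j * e j))

    -- Without √−1, a ↦ ± a² is injective on residues up to sign, hence surjective.
    square-up-to-sign : ¬ Sqrt-1 → ∀ b → ¬ P ∣ b → ∃[ a ] Unit P a × (P ∣ b - a * a ⊎ P ∣ b + a * a)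
    square-up-to-sign no-sqrt b P∤b =
      let j , b²≋j² = half b P∤b
          i , fi≡j  = injective⇒surjective f f-injective j
      in e i , e-unit i , euclid (b - e i * e i) (b + e i * e i)
           (∣-lin₂ 1ℤ -1ℤ b²≋j² (subst (λ z → P ∣ e i * e i * (e i * e i) - e z * e z) fi≡j (f-spec i))
             (identity₃ b (e i * e i) (e j * e j)))
      where
      e²-∤ : ∀ i → ¬ P ∣ e i * e i
      e²-∤ i = [ e-∤ i , e-∤ i ]′ ∘ euclid (e i) (e i)
      f : Fin h → Fin h
      f i = proj₁ (half (e i * e i) (e²-∤ i))
      f-spec : ∀ i → P ∣ e i * e i * (e i * e i) - e (f i) * e (f i)
      f-spec i = proj₂ (half (e i * e i) (e²-∤ i))
      -- Otherwise the quotient e i / e k would be a square root of -1.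
      sum-of-squares : ∀ i k → ¬ P ∣ e i * e i + e k * e k
      sum-of-squares i k P∣sum = let inv v kv≋1 = e-unit k in
        no-sqrt (e i * v , ∣-lin₂ (v * v) (- (e k * v + 1ℤ)) P∣sum kv≋1 (identity₄ (e i) (e k) v))
      -- Equal images mean that the fourth powers agree; of the two factors of their difference, the
      -- sum of squares has just been excluded.
      f-injective : Injective _≡_ _≡_ f
      f-injective {i} {k} fi≡fk =
        [ e-injective i k , (λ P∣sum → contradiction P∣sum (sum-of-squares i k)) ]′
        (euclid (e i * e i - e k * e k) (e i * e i + e k * e k)
          (∣-lin₂ 1ℤ -1ℤ (f-spec i) (subst (λ z → P ∣ e k * e k * (e k * e k) - e z * e z) (sym fi≡fk) (f-spec k))
            (identity₃ (e i * e i) (e k * e k) (e (f i) * e (f i)))))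

    -- Count the pairs (i , j) with i j ≡ ± 1: there is one in each row, and the
    -- diagonal ones are the solutions of i² ≡ 1 and i² ≡ − 1.
    parity-half : parity h ≡ not (does sqrt-1?)
    parity-half = begin
      sum {h} (λ _ → true)          ≡⟨ sum-cong-≗ row ⟨
      sum (λ i → sum (M i))         ≡⟨ sum-symmetric M M-sym ⟩
      sum (λ i → M i i)             ≡⟨ sum-cong-≗ diagonal ⟩
      sum (λ i → A i xor B i)       ≡⟨ ∑-distrib-+ A B ⟩
      sum A xor sum B               ≡⟨ cong₂ _xor_ sum-A sum-B ⟩
      not (does sqrt-1?)            ∎
      where
      open ≡-Reasoning
      M? : ∀ i j → Dec (P ∣ e i * e j * (e i * e j) - 1ℤ)
      M? i j = P ∣? e i * e j * (e i * e j) - 1ℤ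
      M : Fin h → Fin h → Bool
      M i j = does (M? i j)
      A? : ∀ i → Dec (P ∣ e i * e i - 1ℤ)
      A? i = P ∣? e i * e i - 1ℤ
      B? : ∀ i → Dec (P ∣ e i * e i + 1ℤ)
      B? i = P ∣? e i * e i + 1ℤ
      A B : Fin h → Bool
      A i = does (A? i)
      B i = does (B? i)
      true⇒ : ∀ {X : Set} (X? : Dec X) → does X? ≡ true → X
      true⇒ (yes x) refl = x
      M-sym : ∀ i j → M i j ≡ M j i
      M-sym i j = cong (λ z → does (P ∣? z * z - 1ℤ)) (ℤ.*-comm (e i) (e j))
      row : ∀ i → sum (M i) ≡ true
      -- The unique partner of `i` is the representative of ± 1 / e i.
      row i =
        let inv v iv≋1 = e-unit i
            j , v²≋j²  = half v (λ P∣v → P∤1 (∣-lin₂ (e i) -1ℤ P∣v iv≋1 (identity₅ (e i) v)))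
        in sum-single (M i) j
             (dec-true (M? i j) (∣-lin₂ (- (e i * e i)) (e i * v + 1ℤ) v²≋j² iv≋1 (identity₆ (e i) (e j) v)))
             (λ k ik → e-injective k j (combine (e i) (e j) (e k) v (true⇒ (M? i k) ik) iv≋1 v²≋j²))
        where
        combine : ∀ i j k v → P ∣ i * k * (i * k) - 1ℤ → P ∣ i * v - 1ℤ → P ∣ v * v - j * j → P ∣ k * k - j * j
        combine i j k v ik iv vj = ∣-lin₂ 1ℤ 1ℤ
          (∣-lin₂ (v * v) (- (k * k * (i * v + 1ℤ))) ik iv refl) vj
          (identity₇ i j k v)
      factor : ∀ i → e i * e i * (e i * e i) - 1ℤ ≡ (e i * e i - 1ℤ) * (e i * e i + 1ℤ)
      factor i = identity₈ (e i * e i)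
      diagonal : ∀ i → M i i ≡ A i xor B i
      diagonal i = helper (A? i) (B? i)
        where
        helper : (A? : Dec (P ∣ e i * e i - 1ℤ)) (B? : Dec (P ∣ e i * e i + 1ℤ)) → M i i ≡ does A? xor does B?
        -- 1 ≡ -1 would give p ∣ 2. So the two diagonal conditions exclude each other, and `xor`
        -- counts their union.
        helper (yes a) (yes b) = contradiction (∣-lin₂ 1ℤ -1ℤ b a
          (identity₉ (e i * e i))) (∤-small 2<p)
        helper (yes a) (no ¬b) = dec-true (M? i i) (subst (P ∣_) (sym (factor i)) (∣m⇒∣m*n _ a))
        helper (no ¬a) (yes b) = dec-true (M? i i) (subst (P ∣_) (sym (factor i)) (∣n⇒∣m*n (e i * e i - 1ℤ) b))
        helper (no ¬a) (no ¬b) = dec-false (M? i i) ([ ¬a , ¬b ]′ ∘ euclid _ _ ∘ subst (P ∣_) (factor i))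
      sum-A : sum A ≡ true
      sum-A = let one , 1≋ = half 1ℤ P∤1 in
        sum-single A one (dec-true (A? one) (∣-lin₁ -1ℤ 1≋
              (identity₁₀ (e one * e one))))
            (λ i a → e-injective i one (∣-lin₂ 1ℤ 1ℤ (true⇒ (A? i) a) 1≋
              (identity₁₁ (e i * e i) (e one * e one))))
      sum-B : sum B ≡ does sqrt-1?
      sum-B with any? (λ j → P ∣? e j * e j + 1ℤ)
      ... | yes (j , b) = sum-single B j (dec-true (B? j) b)
            (λ i bi → e-injective i j (∣-lin₂ 1ℤ -1ℤ (true⇒ (B? i) bi) b
               (identity₁₂ (e i * e i) (e j * e j))))
      ... | no ¬b = sum-false B (λ i → dec-false (B? i) (λ b → ¬b (i , b)))

  -- ℤ/p as {0} ∪ ± {1, …, h}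
  module OddPrimeField {p : ℕ} (p-prime : Prime p) (h : ℕ) (p≡ : p ≡ suc (h ℕ.+ h)) where

    open PrimeField p-prime

    instance
      p≢0 : NonZero p
      p≢0 = prime⇒nonZero p-prime

    0<h : 0 ℕ.< h
    0<h = half-positive h p-prime p≡

    2<p : 2 ℕ.< p
    2<p = subst (2 ℕ.<_) (sym p≡) (ℕ.s≤s (ℕ.+-mono-≤ 0<h 0<h))

    e : Fin h → ℤ
    e i = + suc (toℕ i)

    e-∤ : ∀ i → ¬ P ∣ e i
    e-∤ i = ∤-small (ℕ.<-≤-trans (ℕ.s≤s (toℕ<n i)) (subst (suc h ℕ.≤_) (sym p≡) (ℕ.s≤s (ℕ.m≤m+n h h))))

    e-injective : ∀ i j → P ∣ e i * e i - e j * e j → i ≡ j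
    e-injective i j div = [ diff⇒≡ , (λ P∣sum → contradiction P∣sum sum-∤) ]′
      (square≋⇒±≋ (e i) (e j) div)
      where
      sum-∤ : ¬ P ∣ e i + e j
      sum-∤ = ∤-small (begin-strict
        suc (toℕ i) ℕ.+ suc (toℕ j) ≤⟨ ℕ.+-mono-≤ (toℕ<n i) (toℕ<n j) ⟩
        h ℕ.+ h                     <⟨ ℕ.n<1+n _ ⟩
        suc (h ℕ.+ h)               ≡⟨ p≡ ⟨
        p                           ∎)
        where open ℕ.≤-Reasoning
      bound : abs (e i - e j) ℕ.< p
      bound = begin-strict
        abs (e i - e j)                ≤⟨ ℤ.∣m⊝n∣≤m⊔n (suc (toℕ i)) (suc (toℕ j)) ⟩
        suc (toℕ i) ℕ.⊔ suc (toℕ j)  ≤⟨ ℕ.⊔-lub (toℕ<n i) (toℕ<n j) ⟩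
        h                            ≤⟨ ℕ.m≤m+n h h ⟩
        h ℕ.+ h                      <⟨ ℕ.n<1+n _ ⟩
        suc (h ℕ.+ h)                ≡⟨ p≡ ⟨
        p                            ∎
        where open ℕ.≤-Reasoning
      diff⇒≡ : P ∣ e i - e j → i ≡ j
      diff⇒≡ P∣diff = toℕ-injective (ℕ.suc-injective (ℤ.+-injective (ℤ.i-j≡0⇒i≡j (e i) (e j)
        (ℤ.∣i∣≡0⇒i≡0 (small-multiple (∣⇒∣ᵤ P∣diff) bound)))))

    half : ∀ x → ¬ P ∣ x → ∃[ j ] P ∣ x * x - e j * e j
    half x P∤x with x %ℕ p | n%ℕd<d x p | a≡a%ℕn+[a/ℕn]*n x p
    ... | zero  | _   | x≡ = contradiction (divides (x /ℕ p) (trans x≡ (ℤ.+-identityˡ _))) P∤x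
    ... | suc k | k<p | x≡ with suc k ℕ.≤? h
    ...   | yes k<h = fromℕ< k<h , subst (λ z → P ∣ x * x - + suc z * + suc z) (sym (toℕ-fromℕ< k<h))
              (≋⇒square≋ x (+ suc k) (divides (x /ℕ p) (trans (cong (_- + suc k) x≡)
                (cancel (+ suc k) (x /ℕ p * P)))))
    ...   | no  k≮h = fromℕ< j<h , subst (λ z → P ∣ x * x - + suc z * + suc z) (sym (toℕ-fromℕ< j<h))
              (≋-⇒square≋ x (+ suc j) (divides (x /ℕ p + 1ℤ) sum≡))
      where
      j : ℕ
      -- Index j stands for the representative j + 1 = p - (k + 1), the reflection of a residue
      -- beyond the half.
      j = p ℕ.∸ suc (suc k)
      j+k : suc j ℕ.+ suc k ≡ p
      j+k = trans (sym (ℕ.+-suc j (suc k))) (ℕ.m∸n+n≡m k<p)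
      j<h : j ℕ.< h
      j<h = ℕ.+-cancelʳ-≤ h (suc j) h (begin
        suc j ℕ.+ h           ≤⟨ ℕ.s≤s⁻¹ (begin
          suc (suc j ℕ.+ h)     ≡⟨ ℕ.+-suc (suc j) h ⟨
          suc j ℕ.+ suc h       ≤⟨ ℕ.+-monoʳ-≤ (suc j) (ℕ.≰⇒> k≮h) ⟩
          suc j ℕ.+ suc k       ≡⟨ j+k ⟩
          p                     ≡⟨ p≡ ⟩
          suc (h ℕ.+ h)         ∎) ⟩
        h ℕ.+ h               ∎)
        where open ℕ.≤-Reasoning
      sum≡ : x + + suc j ≡ (x /ℕ p + 1ℤ) * P
      sum≡ = begin
        x + + suc j                        ≡⟨ cong (_+ + suc j) x≡ ⟩
        + suc k + x /ℕ p * P + + suc j     ≡⟨ shuffle (+ suc k) (x /ℕ p * P) (+ suc j) ⟩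
        x /ℕ p * P + + (suc j ℕ.+ suc k)   ≡⟨ cong (λ z → x /ℕ p * P + + z) j+k ⟩
        x /ℕ p * P + P                     ≡⟨ collect (x /ℕ p) P ⟩
        (x /ℕ p + 1ℤ) * P                  ∎
        where open ≡-Reasoning

    open HalfSystem p-prime 2<p e e-∤ e-injective half public

    private
      p%4 : ∀ {q} r k → suc (q ℕ.+ q) ≡ r ℕ.+ k ℕ.* 4 → h ≡ q → p % 4 ≡ r % 4
      p%4 r k eq refl = trans (cong (_% 4) (trans p≡ eq)) ([m+kn]%n≡m%n r k 4)

    -- As p = 2h + 1, an even h means p ≡ 1 and an odd h means p ≡ 3 modulo 4; `parity-half` ties
    -- the parity of h to the square root.
    sqrt-1-mod4 : Sqrt-1 → p % 4 ≢ 3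
    sqrt-1-mod4 sqrt p%4≡3 =
      [ (λ (k , h≡) → contradiction (trans (sym p%4≡3) (p%4 1 k (1+4k≡ k) h≡)) λ ())
      , (λ (k , h≡) → contradiction (trans (sym (trans (cong parity h≡) (cong not (parity-double k))))
                                      (trans parity-half (cong not (dec-true sqrt-1? sqrt)))) λ ())
      ]′ (double-cases h)

    mod4-sqrt-1 : p % 4 ≢ 3 → Sqrt-1
    mod4-sqrt-1 p%4≢3 = decidable-stable sqrt-1? λ ¬sqrt →
      [ (λ (k , h≡) → contradiction (trans (sym (trans (cong parity h≡) (parity-double k)))
                                      (trans parity-half (cong not (dec-false sqrt-1? ¬sqrt)))) λ ())
      , (λ (k , h≡) → p%4≢3 (p%4 3 k (3+4k≡ k) h≡))
      ]′ (double-cases h)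

  -- Sums of signed unit squares modulo a prime p ≥ 5

  Unit-inverse : ∀ {m} u v → u * v ≋ 1ℤ [mod m ] → Unit m v
  Unit-inverse {m} u v h = inv u (subst (λ z → z ≋ 1ℤ [mod m ]) (ℤ.*-comm u v) h)

  private
    negate : ∀ x e w → - x - - e * w ≡ - (x - e * w)
    negate = ℤ.solve-∀

  sgn-opposite : ∀ ε → sgn (Sign.opposite ε) ≡ - sgn ε
  sgn-opposite Sign.+ = refl
  sgn-opposite Sign.- = refl

  Rep-neg : ∀ {m} s x → Rep m s x → Rep m (map Sign.opposite s) (- x)
  Rep-neg []      x h              = ∣m⇒∣-m h
  Rep-neg {m} (ε ∷ s) x (u , unit , h) = u , unit ,
    subst (Rep m (map Sign.opposite s))
      (sym (trans (cong (λ z → - x - z * (u * u)) (sgn-opposite ε)) (negate x (sgn ε) (u * u))))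
      (Rep-neg s _ h)

  Universal-neg : ∀ {m} s → Universal m s → Universal m (map Sign.opposite s)
  Universal-neg {m} s U x = subst (Rep m (map Sign.opposite s)) (ℤ.neg-involutive x) (Rep-neg s (- x) (U (- x)))

  [+-] [++] [--] [+++] [---] : List Sign
  [+-] = Sign.+ ∷ Sign.- ∷ []
  [++] = Sign.+ ∷ Sign.+ ∷ []
  [--] = Sign.- ∷ Sign.- ∷ []
  [+++] = Sign.+ ∷ [++]
  [---] = Sign.- ∷ [--]

  private
    difference : ∀ x a c h →
      x - 1ℤ * ((a * a + x) * (h * c) * ((a * a + x) * (h * c))) - -1ℤ * ((x - a * a) * (h * c) * ((x - a * a) * (h * c))) ≡
      x * - ((+ 2 * h + 1ℤ) * (a * c * (a * c))) * (+ 2 * h - 1ℤ) + x * - (a * c + 1ℤ) * (a * c - 1ℤ)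
    difference = ℤ.solve-∀

    1+3 : ∀ x → + 3 ≡ 1ℤ * (+ 4 + x) + -1ℤ * (1ℤ + x)
    1+3 = ℤ.solve-∀
    1-5 : ∀ x → + 5 ≡ -1ℤ * (x - + 4) + 1ℤ * (1ℤ + x)
    1-5 = ℤ.solve-∀
    -1+5 : ∀ x → + 5 ≡ 1ℤ * (+ 4 + x) + -1ℤ * (x - 1ℤ)
    -1+5 = ℤ.solve-∀
    -1-3 : ∀ x → + 3 ≡ -1ℤ * (x - + 4) + 1ℤ * (x - 1ℤ)
    -1-3 = ℤ.solve-∀

    flip-sign : ∀ x u v i → x - 1ℤ * (u * u) - 1ℤ * (i * v * (i * v)) ≡
      1ℤ * (x - 1ℤ * (u * u) - -1ℤ * (v * v)) + - (v * v) * (i * i + 1ℤ)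
    flip-sign = ℤ.solve-∀
    sqrt-inverse : ∀ i → i * - i - 1ℤ ≡ -1ℤ * (i * i + 1ℤ)
    sqrt-inverse = ℤ.solve-∀

    transition : ∀ {m} b k a c → b ≡ 1ℤ + k → m ∣ b + a * a → m ∣ k - c * c → m ∣ c * c + a * a + 1ℤ
    transition b k a c refl h h′ = ∣-lin₂ 1ℤ -1ℤ h h′ (split k a c)
      where
      split : ∀ k a c → c * c + a * a + 1ℤ ≡ 1ℤ * (1ℤ + k + a * a) + -1ℤ * (k - c * c)
      split = ℤ.solve-∀
    square-root : ∀ {m} k c → m ∣ k - c * c → m ∣ c → m ∣ k
    square-root k c h h′ = ∣-lin₂ 1ℤ c h h′ (split k c)
      where
      split : ∀ k c → k ≡ 1ℤ * (k - c * c) + c * c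
      split = ℤ.solve-∀
    last-square : ∀ {m} b k c → b ≡ 1ℤ + k → m ∣ b → m ∣ k - c * c → m ∣ c * c + 1ℤ
    last-square b k c refl h h′ = ∣-lin₂ 1ℤ -1ℤ h h′ (split k c)
      where
      split : ∀ k c → c * c + 1ℤ ≡ 1ℤ * (1ℤ + k) + -1ℤ * (k - c * c)
      split = ℤ.solve-∀
    triple-345 : ∀ y t g → y - (+ 3 * g * t * (+ 3 * g * t) + + 4 * g * t * (+ 4 * g * t)) ≡
      1ℤ * (y - t * t) + - (t * t) * (+ 5 * g + 1ℤ) * (+ 5 * g - 1ℤ)
    triple-345 = ℤ.solve-∀
    neg-squares : ∀ y t c e → y - (c * t * (c * t) + e * t * (e * t)) ≡
      1ℤ * (y + t * t) + - (t * t) * (c * c + e * e + 1ℤ)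
    neg-squares = ℤ.solve-∀
    three-squares : ∀ x w u v → x - 1ℤ * (w * w) - 1ℤ * (u * u) - 1ℤ * (v * v) ≡
      1ℤ * (x - w * w - (u * u + v * v))
    three-squares = ℤ.solve-∀

  module LargePrime {p : ℕ} (p-prime : Prime p) (5<p : 5 ℕ.< p) where

    open PrimeField p-prime

    P∤ : ∀ k .{{_ : NonZero k}} → k ℕ.≤ 5 → ¬ P ∣ + k
    P∤ k k≤5 = ∤-small (ℕ.≤-<-trans k≤5 5<p)

    P∤2 : ¬ P ∣ + 2
    P∤2 = P∤ 2 (ℕ.m≤m+n 2 3)
    P∤3 : ¬ P ∣ + 3
    P∤3 = P∤ 3 (ℕ.m≤m+n 3 2)
    P∤5 : ¬ P ∣ + 5
    P∤5 = P∤ 5 ℕ.≤-refl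

    -- u² − v² = x for u = (a + x / a) / 2 and v = (x / a − a) / 2.
    Rep-difference : ∀ x a → Unit P a → ¬ P ∣ a * a + x → ¬ P ∣ x - a * a → Rep P [+-] x
    Rep-difference x a (inv c ac≋1) u≢0 v≢0 =
      helper (∤⇒Unit P∤2)
      where
      helper : Unit P (+ 2) → Rep P [+-] x
      helper (inv h 2h≋1) =
        (a * a + x) * (h * c) , Unit-* (∤⇒Unit u≢0) hc , (x - a * a) * (h * c) , Unit-* (∤⇒Unit v≢0) hc ,
        ∣-lin₂ (x * - ((+ 2 * h + 1ℤ) * (a * c * (a * c)))) (x * - (a * c + 1ℤ)) 2h≋1 ac≋1
          (difference x a c h)
        where
        hc : Unit P (h * c)
        hc = Unit-* (Unit-inverse (+ 2) h 2h≋1) (Unit-inverse a c ac≋1)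

    -- `Rep-difference` with a = 1 breaks down only for x ≡ ± 1. Then a = 2 works, because 4 ± 1 are
    -- 3 and 5; this is where p > 5 enters.
    universal-+- : Universal P [+-]
    universal-+- x = helper (P ∣? 1ℤ + x) (P ∣? x - 1ℤ)
      where
      helper : Dec (P ∣ 1ℤ + x) → Dec (P ∣ x - 1ℤ) → Rep P [+-] x
      helper (no ¬a) (no ¬b) = Rep-difference x 1ℤ Unit-1 ¬a ¬b
      helper (yes a) _ = Rep-difference x (+ 2) (∤⇒Unit P∤2)
        (λ b → P∤3 (∣-lin₂ 1ℤ -1ℤ b a (1+3 x))) (λ b → P∤5 (∣-lin₂ -1ℤ 1ℤ b a (1-5 x)))
      helper _ (yes a) = Rep-difference x (+ 2) (∤⇒Unit P∤2)
        (λ b → P∤5 (∣-lin₂ 1ℤ -1ℤ b a (-1+5 x))) (λ b → P∤3 (∣-lin₂ -1ℤ 1ℤ b a (-1-3 x)))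

    -- With i² ≡ -1 the term - v² becomes + (i v)².
    universal-++ : Sqrt-1 → Universal P [++]
    universal-++ (i , i²≋-1) x =
      helper (universal-+- x)
      where
      helper : Rep P [+-] x → Rep P [++] x
      helper (u , uu , v , uv , h) =
        u , uu , i * v , Unit-* {u = i} (inv (- i) (∣-lin₁ -1ℤ i²≋-1 (sqrt-inverse i))) uv ,
        ∣-lin₂ 1ℤ (- (v * v)) h i²≋-1 (flip-sign x u v i)

    module NoSqrt (¬sqrt : ¬ Sqrt-1)
      (square-up-to-sign : ∀ b → ¬ P ∣ b → ∃[ a ] Unit P a × (P ∣ b - a * a ⊎ P ∣ b + a * a)) where

      -1-as-two-squares : Set
      -1-as-two-squares = ∃[ c ] ∃[ e ] Unit P c × Unit P e × P ∣ c * c + e * e + 1ℤ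

      -- As 1 is a square and −1 is not, some square k is followed by a nonsquare k + 1.
      search : ∀ k → suc k ℕ.< p → (∃[ c ] P ∣ + suc k - c * c) ⊎ -1-as-two-squares
      search zero    _   = inj₁ (1ℤ , divides 0ℤ refl)
      search (suc k) k<p = [ step , inj₂ ]′ (search k (ℕ.<⇒≤ k<p))
        where
        b : ℤ
        b = + suc (suc k)
        step : (∃[ c ] P ∣ + suc k - c * c) → (∃[ c ] P ∣ b - c * c) ⊎ -1-as-two-squares
        step (c , k≋c²) = next (square-up-to-sign b (∤-small k<p))
          where
          unit-c : Unit P c
          unit-c = ∤⇒Unit (∤-small {k = suc k} (ℕ.<⇒≤ k<p) ∘ square-root (+ suc k) c k≋c²)
          next : ∃[ a ] Unit P a × (P ∣ b - a * a ⊎ P ∣ b + a * a) → (∃[ a ] P ∣ b - a * a) ⊎ -1-as-two-squares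
          next (a , unit-a , inj₁ b≋a²)  = inj₁ (a , b≋a²)
          next (a , unit-a , inj₂ b≋-a²) =
            -- Here c² + 1 ≡ b ≡ - a².
            inj₂ (c , a , unit-c , unit-a , transition b (+ suc k) a c refl b≋-a² k≋c²)

      -- Were the search never to meet a nonsquare, it would reach p - 1 and make -1 a square.
      neg-one : -1-as-two-squares
      neg-one = [ (λ (c , h) → contradiction (c , last-square (+ suc (suc k)) (+ suc k) c refl P∣2+k h) ¬sqrt) , id ]′
                (search k (subst (suc (suc k) ℕ.≤_) 2+k≡p ℕ.≤-refl))
        where
        k : ℕ
        k = p ℕ.∸ 2
        2+k≡p : 2 ℕ.+ k ≡ p
        2+k≡p = ℕ.m+[n∸m]≡n {2} {p} (ℕ.≤-trans (ℕ.m≤m+n 2 4) 5<p)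
        P∣2+k : P ∣ + suc (suc k)
        P∣2+k = ∣ᵤ⇒∣ (ℕ.∣-reflexive (sym 2+k≡p))

      -- Up to sign y is a square t². The Pythagorean triple gives t² = (3t / 5)² + (4t / 5)², and
      -- `neg-one` splits - t².
      two-squares : ∀ y → ¬ P ∣ y → ∃[ u ] ∃[ v ] Unit P u × Unit P v × y ≋ u * u + v * v [mod P ]
      two-squares y P∤y = let t , ut , y≋ = square-up-to-sign y P∤y in
        [ square t ut (∤⇒Unit P∤5) , neg-square t ut neg-one ]′ y≋
        where
        square : ∀ t → Unit P t → Unit P (+ 5) → P ∣ y - t * t →
                 ∃[ u ] ∃[ v ] Unit P u × Unit P v × y ≋ u * u + v * v [mod P ]
        square t ut (inv g 5g≋1) y≋t² = + 3 * g * t , + 4 * g * t ,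
          Unit-* (Unit-* (∤⇒Unit P∤3) ug) ut , Unit-* (Unit-* (∤⇒Unit (P∤ 4 (ℕ.m≤m+n 4 1))) ug) ut ,
          ∣-lin₂ 1ℤ (- (t * t) * (+ 5 * g + 1ℤ)) y≋t² 5g≋1 (triple-345 y t g)
          where
          ug : Unit P g
          ug = Unit-inverse (+ 5) g 5g≋1
        neg-square : ∀ t → Unit P t → -1-as-two-squares → P ∣ y + t * t →
                     ∃[ u ] ∃[ v ] Unit P u × Unit P v × y ≋ u * u + v * v [mod P ]
        neg-square t ut (c , e , uc , ue , h) y≋-t² =
          c * t , e * t , Unit-* uc ut , Unit-* ue ut ,
          ∣-lin₂ 1ℤ (- (t * t)) y≋-t² h (neg-squares y t c e)

      universal-+++′ : Universal P [+++]
      universal-+++′ x = helper (P ∣? x - 1ℤ)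
        where
        finish : ∀ w → Unit P w → ¬ P ∣ x - w * w → Rep P [+++] x
        finish w uw ∤ = extend (two-squares (x - w * w) ∤)
          where
          extend : ∃[ u ] ∃[ v ] Unit P u × Unit P v × x - w * w ≋ u * u + v * v [mod P ] → Rep P [+++] x
          extend (u , v , uu , uv , h) = w , uw , u , uu , v , uv , ∣-lin₁ 1ℤ h (three-squares x w u v)
        helper : Dec (P ∣ x - 1ℤ) → Rep P [+++] x
        helper (no ∤)  = finish 1ℤ Unit-1 ∤
        -- For x ≡ 1, subtracting 1 leaves 0, but subtracting 4 leaves -3, a nonzero residue.
        helper (yes a) = finish (+ 2) (∤⇒Unit P∤2) (λ b → P∤3 (∣-lin₂ -1ℤ 1ℤ b a (-1-3 x)))

  odd-prime : ∀ {p} → Prime p → 2 ℕ.< p → ∃[ h ] p ≡ suc (h ℕ.+ h)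
  odd-prime {p} p-prime 2<p with double-cases p
  ... | inj₂ h≡        = h≡
  ... | inj₁ (k , p≡) = contradiction p-prime (composite⇒¬prime
    (composite-≢ 2 {{nt}} {{prime⇒nonZero p-prime}} (λ 2≡p → ℕ.<⇒≢ 2<p 2≡p)
      (ℕ.divides k (trans p≡ (trans (cong (k ℕ.+_) (sym (ℕ.+-identityʳ k))) (ℕ.*-comm 2 k))))))
    where
    nt : ℕ.NonTrivial 2
    nt = _

  module _ {p : ℕ} (p-prime : Prime p) (5<p : 5 ℕ.< p) where

    open PrimeField p-prime
    open LargePrime p-prime 5<p

    private
      2<p : 2 ℕ.< p
      2<p = ℕ.≤-trans (ℕ.m≤m+n 3 3) 5<p

    universal-+++ : Universal P [+++]
    universal-+++ = let h , p≡ = odd-prime p-prime 2<p in helper h p≡ (OddPrimeField.sqrt-1? p-prime h p≡)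
      where
      helper : ∀ h (p≡ : p ≡ suc (h ℕ.+ h)) → Dec Sqrt-1 → Universal P [+++]
      helper h p≡ (yes sqrt) = Universal-∷ Sign.+ [++] (universal-++ sqrt)
      helper h p≡ (no ¬sqrt) = NoSqrt.universal-+++′ ¬sqrt (OddPrimeField.square-up-to-sign p-prime h p≡ ¬sqrt)

  mod4⇒Sqrt-1 : ∀ {p} (p-prime : Prime p) → 2 ℕ.< p → p % 4 ≢ 3 → PrimeField.Sqrt-1 p-prime
  mod4⇒Sqrt-1 p-prime 2<p p%4≢3 = let h , p≡ = odd-prime p-prime 2<p in OddPrimeField.mod4-sqrt-1 p-prime h p≡ p%4≢3

  mod4⇒¬Sqrt-1 : ∀ {p} (p-prime : Prime p) → 2 ℕ.< p → p % 4 ≡ 3 → ¬ PrimeField.Sqrt-1 p-prime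
  mod4⇒¬Sqrt-1 p-prime 2<p p%4≡3 sqrt = let h , p≡ = odd-prime p-prime 2<p in OddPrimeField.sqrt-1-mod4 p-prime h p≡ sqrt p%4≡3

  private
    absorb₁ : ∀ x e w d z → x - e * w - z ≡ 1ℤ * (x - (d + z)) + -1ℤ * (e * w - d)
    absorb₁ = ℤ.solve-∀

  -- Both signs are squares modulo 5.
  Rep-5 : ∀ s t x → List.length s ≡ List.length t → x ≋ signSum t [mod + 5 ] → Rep (+ 5) s x
  Rep-5 []      []      x eq h = subst (+ 5 ∣_) (ℤ.+-identityʳ x) h
  Rep-5 (ε ∷ s) (δ ∷ t) x eq h = let u , unit , εu² = root ε δ in
    u , unit , Rep-5 s t _ (ℕ.suc-injective eq)
      (∣-lin₂ 1ℤ -1ℤ h εu² (absorb₁ x (sgn ε) (u * u) (sgn δ) (signSum t)))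
    where
    root : ∀ ε δ → ∃[ u ] Unit (+ 5) u × sgn ε * (u * u) ≋ sgn δ [mod + 5 ]
    root Sign.+ Sign.+ = 1ℤ , Unit-1 , divides 0ℤ refl
    root Sign.- Sign.- = 1ℤ , Unit-1 , divides 0ℤ refl
    root Sign.+ Sign.- = + 2 , inv (+ 3) (divides 1ℤ refl) , divides 1ℤ refl
    root Sign.- Sign.+ = + 2 , inv (+ 3) (divides 1ℤ refl) , divides -1ℤ refl

  -- By `Rep-5` the signs can be chosen afresh and only their number matters. Four signs sum to -4,
  -- -2, 0, 2 or 4, one value for each residue modulo 5.
  universal-5 : ∀ s → 4 ℕ.≤ List.length s → Universal (+ 5) s
  universal-5 (a ∷ b ∷ c ∷ d ∷ []) _ x =
    let t , len , r≋ = four (x %ℕ 5) (n%ℕd<d x 5)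
    in Rep-5 (a ∷ b ∷ c ∷ d ∷ []) t x (sym len) (≋-trans x (+ (x %ℕ 5)) (signSum t) (%ℕ-≋ x 5) r≋)
    where
    four : ∀ r → r ℕ.< 5 → ∃[ t ] List.length t ≡ 4 × + r ≋ signSum t [mod + 5 ]
    four 0 _ = Sign.+ ∷ Sign.+ ∷ Sign.- ∷ Sign.- ∷ [] , refl , divides 0ℤ refl
    four 1 _ = Sign.- ∷ Sign.- ∷ Sign.- ∷ Sign.- ∷ [] , refl , divides 1ℤ refl
    four 2 _ = Sign.+ ∷ Sign.+ ∷ Sign.+ ∷ Sign.- ∷ [] , refl , divides 0ℤ refl
    four 3 _ = Sign.- ∷ Sign.- ∷ Sign.- ∷ Sign.+ ∷ [] , refl , divides 1ℤ refl
    four 4 _ = Sign.+ ∷ Sign.+ ∷ Sign.+ ∷ Sign.+ ∷ [] , refl , divides 0ℤ refl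
    four (suc (suc (suc (suc (suc r))))) (ℕ.s≤s (ℕ.s≤s (ℕ.s≤s (ℕ.s≤s (ℕ.s≤s ())))))
  universal-5 (a ∷ s@(_ ∷ _ ∷ _ ∷ _ ∷ _)) _ = Universal-∷ a s (universal-5 s (ℕ.m≤m+n 4 _))
  universal-5 (_ ∷ [])         (ℕ.s≤s ())
  universal-5 (_ ∷ _ ∷ [])     (ℕ.s≤s (ℕ.s≤s ()))
  universal-5 (_ ∷ _ ∷ _ ∷ []) (ℕ.s≤s (ℕ.s≤s (ℕ.s≤s ())))

  -- Distances and diameters in finite graphs

  module FiniteGraph {n : ℕ} {_~_ : Rel (Fin n) 0ℓ} (_~?_ : Decidable _~_) where

    open Graph _~_ hiding (HasDiameter)

    WalkOfLength : ℕ → Rel (Fin n) 0ℓ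
    WalkOfLength k x y = ∃[ w ] length {x} {y} w ≡ k

    walkOfLength? : ∀ k x y → Dec (WalkOfLength k x y)
    walkOfLength? zero x y = map′ (λ { refl → Star.ε , refl }) (λ { (Star.ε , _) → refl }) (x Fin.≟ y)
    walkOfLength? (suc k) x y = map′
      (λ { (z , x~z , w , refl) → x~z ◅ w , refl })
      (λ { (_◅_ {j = z} x~z w , refl) → z , x~z , w , refl })
      (any? (λ z → (x ~? z) ×-dec walkOfLength? k z y))

    -- Descent on the length of a known walk: with finitely many vertices it is decidable whether a
    -- shorter walk exists, and where none does the distance is reached.
    distance : ∀ {x y} (w : Walk x y) → ∃[ k ] HasDistance x y k × k ℕ.≤ length w
    distance {x} {y} w = <-rec (λ ℓ → WalkOfLength ℓ x y → ∃[ k ] HasDistance x y k × k ℕ.≤ ℓ) shorten _ (w , refl)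
      where
      shorten : ∀ ℓ → (∀ {m} → m ℕ.< ℓ → WalkOfLength m x y → ∃[ k ] HasDistance x y k × k ℕ.≤ m) →
                WalkOfLength ℓ x y → ∃[ k ] HasDistance x y k × k ℕ.≤ ℓ
      shorten ℓ rec v with ℕ.anyUpTo? (λ m → walkOfLength? m x y) ℓ
      ... | yes (m , m<ℓ , u) = let k , dist , k≤m = rec m<ℓ u in k , dist , ℕ.≤-trans k≤m (ℕ.<⇒≤ m<ℓ)
      ... | no  ¬shorter      = ℓ , (v , λ u → ℕ.≮⇒≥ (λ u<ℓ → ¬shorter (length u , u<ℓ , u , refl))) , ℕ.≤-refl

    Within : ℕ → Rel (Fin n) 0ℓ
    Within d x y = ∃[ w ] length {x} {y} w ℕ.≤ d

    within? : ∀ d x y → Dec (Within d x y)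
    within? d x y = map′ (λ { (k , k≤d , w , refl) → w , ℕ.s≤s⁻¹ k≤d }) (λ (w , w≤d) → length w , ℕ.s≤s w≤d , w , refl)
      (ℕ.anyUpTo? (λ k → walkOfLength? k x y) (suc d))

    hasDiameter : ∀ {d} → (∀ x y → Within d x y) → ∃[ x ] ∃[ y ] (∀ (w : Walk x y) → d ℕ.≤ length w) → HasDiameter _~_ d
    hasDiameter {d} within (x , y , far) =
      (λ u v → let w , w≤d = within u v ; k , dist , k≤w = distance w in k , dist , ℕ.≤-trans k≤w w≤d) ,
      x , y , (let w , w≤d = within x y in w , ℕ.≤-antisym w≤d (far w)) , far

    -- Gives a diameter whose value is not known in advance. The bound is lowered while all pairs
    -- stay within it; when this fails, the offending pair realises the diameter.
    diameter≤ : Fin n → ∀ b → (∀ x y → Within b x y) → ∃[ d ] HasDiameter _~_ d × d ℕ.≤ b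
    diameter≤ v zero    within = 0 , hasDiameter within (v , v , λ _ → ℕ.z≤n) , ℕ.z≤n
    diameter≤ v (suc b) within with all? (λ x → all? (λ y → within? b x y))
    ... | yes within′ = let d , diam , d≤b = diameter≤ v b within′ in d , diam , ℕ.m≤n⇒m≤1+n d≤b
    ... | no  ¬within with ¬∀⟶∃¬ n _ (λ x → all? (λ y → within? b x y)) ¬within
    ...   | x , ¬within-x with ¬∀⟶∃¬ n _ (λ y → within? b x y) ¬within-x
    ...     | y , ¬within-xy = suc b , hasDiameter within (x , y , λ w → ℕ.≰⇒> (λ w≤b → ¬within-xy (w , w≤b))) , ℕ.≤-refl

  -- Walks in the Cayley graph and representations modulo n

  private
    step-split : ∀ a b c e → c - b - (a - b - e) ≡ -1ℤ * (a - c - e)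
    step-split = ℤ.solve-∀
    fold-split : ∀ a b c e → a - b - e - (c - b) ≡ -1ℤ * (c - (a - e))
    fold-split = ℤ.solve-∀
    edge-split : ∀ a c e → a - c - e ≡ -1ℤ * (c - (a - e))
    edge-split = ℤ.solve-∀

  module Residues (n : ℕ) .{{_ : NonZero n}} where

    N : ℤ
    N = + n

    ⟦_⟧ : ℤmod n → ℤ
    ⟦ a ⟧ = + toℕ a

    ⟦⟧-injective : ∀ a b → ⟦ a ⟧ ≋ ⟦ b ⟧ [mod N ] → a ≡ b
    ⟦⟧-injective a b h = toℕ-injective (≋⇒≡ (toℕ<n a) (toℕ<n b) h)

    ⟦mod⟧ : ∀ m → ⟦ m mod n ⟧ ≋ + m [mod N ]
    ⟦mod⟧ m = subst (λ z → + z ≋ + m [mod N ]) (sym (toℕ-fromℕ< (m%n<n m n)))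
                (≋-sym (+ m) (+ (m % n)) (%ℕ-≋ (+ m) n))

    ⟦+⟧ : ∀ a b → ⟦ a +ₙ b ⟧ ≋ ⟦ a ⟧ + ⟦ b ⟧ [mod N ]
    ⟦+⟧ a b = ⟦mod⟧ (toℕ a ℕ.+ toℕ b)

    ⟦*⟧ : ∀ a b → ⟦ a *ₙ b ⟧ ≋ ⟦ a ⟧ * ⟦ b ⟧ [mod N ]
    ⟦*⟧ a b = subst (λ z → ⟦ a *ₙ b ⟧ ≋ z [mod N ]) (ℤ.pos-* (toℕ a) (toℕ b)) (⟦mod⟧ (toℕ a ℕ.* toℕ b))

    ⟦neg⟧ : ∀ a → ⟦ -ₙ a ⟧ ≋ - ⟦ a ⟧ [mod N ]
    ⟦neg⟧ a = ≋-trans ⟦ -ₙ a ⟧ (+ (n ℕ.∸ toℕ a)) (- ⟦ a ⟧) (⟦mod⟧ (n ℕ.∸ toℕ a))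
      (divides 1ℤ (begin
        + (n ℕ.∸ toℕ a) - - ⟦ a ⟧  ≡⟨ cong (_+_ (+ (n ℕ.∸ toℕ a))) (ℤ.neg-involutive ⟦ a ⟧) ⟩
        + (n ℕ.∸ toℕ a ℕ.+ toℕ a)  ≡⟨ cong +_ (ℕ.m∸n+n≡m (ℕ.<⇒≤ (toℕ<n a))) ⟩
        N                          ≡⟨ ℤ.*-identityˡ N ⟨
        1ℤ * N                     ∎))
      where open ≡-Reasoning

    ⟦-⟧ : ∀ a b → ⟦ a -ₙ b ⟧ ≋ ⟦ a ⟧ - ⟦ b ⟧ [mod N ]
    ⟦-⟧ a b = ≋-trans ⟦ a -ₙ b ⟧ (⟦ a ⟧ + ⟦ -ₙ b ⟧) (⟦ a ⟧ - ⟦ b ⟧) (⟦+⟧ a (-ₙ b))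
      (≋-+ ⟦ a ⟧ ⟦ -ₙ b ⟧ ⟦ a ⟧ (- ⟦ b ⟧) (≋-reflexive {x = ⟦ a ⟧} refl) (⟦neg⟧ b))

    ⟦1⟧ : ⟦ 1ₙ ⟧ ≋ 1ℤ [mod N ]
    ⟦1⟧ = ⟦mod⟧ 1

    residue : ℤ → ℤmod n
    residue x = fromℕ< (n%ℕd<d x n)

    ⟦residue⟧ : ∀ x → ⟦ residue x ⟧ ≋ x [mod N ]
    ⟦residue⟧ x = subst (λ z → + z ≋ x [mod N ]) (sym (toℕ-fromℕ< (n%ℕd<d x n)))
                    (≋-sym x (+ (x %ℕ n)) (%ℕ-≋ x n))

    SignedSquare : ℤ → Set
    SignedSquare x = ∃[ ε ] ∃[ u ] Unit N u × x ≋ sgn ε * (u * u) [mod N ]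

    IsUnit⇒Unit : ∀ {u} → IsUnit u → Unit N ⟦ u ⟧
    IsUnit⇒Unit {u} (v , uv≡1) = inv ⟦ v ⟧
      (≋-trans (⟦ u ⟧ * ⟦ v ⟧) ⟦ u *ₙ v ⟧ 1ℤ (≋-sym ⟦ u *ₙ v ⟧ (⟦ u ⟧ * ⟦ v ⟧) (⟦*⟧ u v))
        (subst (λ z → ⟦ z ⟧ ≋ 1ℤ [mod N ]) (sym uv≡1) ⟦1⟧))

    Unit⇒IsUnit : ∀ {u} → Unit N u → IsUnit (residue u)
    Unit⇒IsUnit {u} (inv v uv≋1) = residue v , ⟦⟧-injective (residue u *ₙ residue v) 1ₙ
      (≋-trans ⟦ residue u *ₙ residue v ⟧ (u * v) ⟦ 1ₙ ⟧ (residue-* u v)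
        (≋-trans (u * v) 1ℤ ⟦ 1ₙ ⟧ uv≋1 (≋-sym ⟦ 1ₙ ⟧ 1ℤ ⟦1⟧)))
      where
      residue-* : ∀ u v → ⟦ residue u *ₙ residue v ⟧ ≋ u * v [mod N ]
      residue-* u v = ≋-trans ⟦ residue u *ₙ residue v ⟧ (⟦ residue u ⟧ * ⟦ residue v ⟧) (u * v)
        (⟦*⟧ (residue u) (residue v)) (≋-* ⟦ residue u ⟧ ⟦ residue v ⟧ u v (⟦residue⟧ u) (⟦residue⟧ v))

    T⇒SignedSquare : ∀ {x} → x ∈ T n → SignedSquare ⟦ x ⟧
    T⇒SignedSquare (q , (u , unit , q≡u²) , inj₁ x≡q) = Sign.+ , ⟦ u ⟧ , IsUnit⇒Unit unit ,
      subst₂ (λ y z → ⟦ y ⟧ ≋ z [mod N ]) (sym (trans x≡q q≡u²)) (sym (ℤ.*-identityˡ (⟦ u ⟧ * ⟦ u ⟧))) (⟦*⟧ u u)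
    T⇒SignedSquare (q , (u , unit , q≡u²) , inj₂ x≡-q) = Sign.- , ⟦ u ⟧ , IsUnit⇒Unit unit ,
      subst₂ (λ y z → ⟦ y ⟧ ≋ z [mod N ]) (sym (trans x≡-q (cong -ₙ_ q≡u²))) (sym (ℤ.-1*i≡-i (⟦ u ⟧ * ⟦ u ⟧)))
        (≋-trans ⟦ -ₙ (u *ₙ u) ⟧ (- ⟦ u *ₙ u ⟧) (- (⟦ u ⟧ * ⟦ u ⟧)) (⟦neg⟧ (u *ₙ u))
          (≋-neg ⟦ u *ₙ u ⟧ (⟦ u ⟧ * ⟦ u ⟧) (⟦*⟧ u u)))

    residue-square : ∀ u → ⟦ residue u *ₙ residue u ⟧ ≋ u * u [mod N ]
    residue-square u = ≋-trans ⟦ residue u *ₙ residue u ⟧ (⟦ residue u ⟧ * ⟦ residue u ⟧) (u * u)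
      (⟦*⟧ (residue u) (residue u)) (≋-* ⟦ residue u ⟧ ⟦ residue u ⟧ u u (⟦residue⟧ u) (⟦residue⟧ u))

    SignedSquare⇒T : ∀ {x} → SignedSquare ⟦ x ⟧ → x ∈ T n
    SignedSquare⇒T {x} (Sign.+ , u , unit , x≋) = r *ₙ r , (r , Unit⇒IsUnit unit , refl) ,
      inj₁ (⟦⟧-injective x (r *ₙ r) (≋-trans ⟦ x ⟧ (u * u) ⟦ r *ₙ r ⟧
        (subst (λ z → ⟦ x ⟧ ≋ z [mod N ]) (ℤ.*-identityˡ (u * u)) x≋) (≋-sym ⟦ r *ₙ r ⟧ (u * u) (residue-square u))))
      where
      r : ℤmod n
      r = residue u
    SignedSquare⇒T {x} (Sign.- , u , unit , x≋) = r *ₙ r , (r , Unit⇒IsUnit unit , refl) ,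
      inj₂ (⟦⟧-injective x (-ₙ (r *ₙ r)) (≋-trans ⟦ x ⟧ (- (u * u)) ⟦ -ₙ (r *ₙ r) ⟧
        (subst (λ z → ⟦ x ⟧ ≋ z [mod N ]) (ℤ.-1*i≡-i (u * u)) x≋)
        (≋-sym ⟦ -ₙ (r *ₙ r) ⟧ (- (u * u)) (≋-trans ⟦ -ₙ (r *ₙ r) ⟧ (- ⟦ r *ₙ r ⟧) (- (u * u)) (⟦neg⟧ (r *ₙ r))
          (≋-neg ⟦ r *ₙ r ⟧ (u * u) (residue-square u))))))
      where
      r : ℤmod n
      r = residue u

    open Graph (G n) hiding (HasDiameter)

    -- Every edge takes one signed unit square off the difference of the endpoints; the list records
    -- the signs.
    walk⇒Rep : ∀ {a b} (w : Walk a b) → ∃[ s ] List.length s ≡ length w × Rep N s (⟦ a ⟧ - ⟦ b ⟧)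
    walk⇒Rep {a} Star.ε = [] , refl , subst (N ∣_) (sym (ℤ.+-inverseʳ ⟦ a ⟧)) (divides 0ℤ refl)
    walk⇒Rep {a} {b} (_◅_ {j = c} a~c w) = extend (T⇒SignedSquare a~c) (walk⇒Rep w)
      where
      extend : SignedSquare ⟦ a -ₙ c ⟧ → ∃[ s ] List.length s ≡ length w × Rep N s (⟦ c ⟧ - ⟦ b ⟧) →
               ∃[ s ] List.length s ≡ suc (length w) × Rep N s (⟦ a ⟧ - ⟦ b ⟧)
      extend (δ , u , unit , h) (s , len , rep) = δ ∷ s , cong suc len , u , unit ,
        Rep-resp s (⟦ c ⟧ - ⟦ b ⟧) (⟦ a ⟧ - ⟦ b ⟧ - e) (∣-lin₁ -1ℤ a-c≋e (step-split ⟦ a ⟧ ⟦ b ⟧ ⟦ c ⟧ e)) rep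
        where
        e : ℤ
        e = sgn δ * (u * u)
        a-c≋e : ⟦ a ⟧ - ⟦ c ⟧ ≋ e [mod N ]
        a-c≋e = ≋-trans (⟦ a ⟧ - ⟦ c ⟧) ⟦ a -ₙ c ⟧ e (≋-sym ⟦ a -ₙ c ⟧ (⟦ a ⟧ - ⟦ c ⟧) (⟦-⟧ a c)) h

    Rep⇒walk : ∀ s {a b} → Rep N s (⟦ a ⟧ - ⟦ b ⟧) → ∃[ w ] length {a} {b} w ≡ List.length s
    Rep⇒walk [] {a} {b} h with ⟦⟧-injective a b h
    ... | refl = Star.ε , refl
    Rep⇒walk (δ ∷ s) {a} {b} (u , unit , rep) = prepend (Rep⇒walk s {c} {b}
      (Rep-resp s (⟦ a ⟧ - ⟦ b ⟧ - e) (⟦ c ⟧ - ⟦ b ⟧) (∣-lin₁ -1ℤ (⟦residue⟧ (⟦ a ⟧ - e)) (fold-split ⟦ a ⟧ ⟦ b ⟧ ⟦ c ⟧ e)) rep))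
      where
      e : ℤ
      e = sgn δ * (u * u)
      c : ℤmod n
      c = residue (⟦ a ⟧ - e)
      a~c : G n a c
      a~c = SignedSquare⇒T (δ , u , unit , ≋-trans ⟦ a -ₙ c ⟧ (⟦ a ⟧ - ⟦ c ⟧) e (⟦-⟧ a c)
              (∣-lin₁ -1ℤ (⟦residue⟧ (⟦ a ⟧ - e)) (edge-split ⟦ a ⟧ ⟦ c ⟧ e)))
      prepend : ∃[ w ] length {c} {b} w ≡ List.length s → ∃[ w ] length {a} {b} w ≡ suc (List.length s)
      prepend (w , len) = a~c ◅ w , cong suc len

    IsUnit? : ∀ u → Dec (IsUnit u)
    IsUnit? u = any? (λ v → u *ₙ v Fin.≟ 1ₙ)

    G? : Decidable (G n)
    G? a b = any? (λ q → any? (λ u → IsUnit? u ×-dec q Fin.≟ u *ₙ u) ×-dec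
                         (a -ₙ b Fin.≟ q ⊎-dec a -ₙ b Fin.≟ -ₙ q))

    -- Translations are automorphisms, so distances depend on differences only, and bounds can be
    -- stated for one integer in place of two vertices.
    Covers : ℕ → Set
    Covers d = ∀ x → ∃[ s ] List.length s ℕ.≤ d × Rep N s x

    Needs : ℤ → ℕ → Set
    Needs x d = ∀ s → Rep N s x → d ℕ.≤ List.length s

    open FiniteGraph G?

    covers⇒within : ∀ {d} → Covers d → ∀ a b → Within d a b
    covers⇒within covers a b =
      let s , s≤d , rep = covers (⟦ a ⟧ - ⟦ b ⟧)
          w , len       = Rep⇒walk s {a} {b} rep
      in w , subst (ℕ._≤ _) (sym len) s≤d

    diameter : ∀ {d} → Covers d → ∀ x → Needs x d → HasDiameter (G n) d
    diameter {d} covers x needs = hasDiameter (covers⇒within covers) (residue x , residue 0ℤ , far)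
      where
      far : ∀ (w : Walk (residue x) (residue 0ℤ)) → d ℕ.≤ length w
      far w = let s , len , rep = walk⇒Rep w in
        subst (d ℕ.≤_) len (needs s (Rep-resp s (⟦ residue x ⟧ - ⟦ residue 0ℤ ⟧) x
          (subst (λ z → ⟦ residue x ⟧ - ⟦ residue 0ℤ ⟧ ≋ z [mod N ]) (ℤ.+-identityʳ x)
            (≋-+ ⟦ residue x ⟧ (- ⟦ residue 0ℤ ⟧) x (- 0ℤ) (⟦residue⟧ x) (≋-neg ⟦ residue 0ℤ ⟧ 0ℤ (⟦residue⟧ 0ℤ)))) rep))

    covers⇒diameter≤ : ∀ {d} → Covers d → ∃[ k ] HasDiameter (G n) k × k ℕ.≤ d
    covers⇒diameter≤ covers = diameter≤ (residue 0ℤ) _ (covers⇒within covers)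

  -- Upper bounds

  Universal-replicate : ∀ {m} i ε s → Universal m s → Universal m (replicate i ε ++ s)
  Universal-replicate zero    ε s U = U
  Universal-replicate (suc i) ε s U = Universal-∷ ε (replicate i ε ++ s) (Universal-replicate i ε s U)

  -- A table picks for each residue r modulo d a sign list with sum r and length
  -- between ℓ and D.  It prepends equal signs to a base, so that the list is
  -- universal modulo every prime for which the base is.
  Fits : (d ℓ D r : ℕ) → List Sign → Set
  Fits d ℓ D r s = (ℓ ℕ.≤ List.length s × List.length s ℕ.≤ D) × + r ≋ signSum s [mod + d ]

  fits? : ∀ d ℓ D r s → Dec (Fits d ℓ D r s)
  fits? d ℓ D r s = (ℓ ℕ.≤? List.length s ×-dec List.length s ℕ.≤? D) ×-dec + d ∣? + r - signSum s

  -- The bound on `i` makes the search finite. For nonempty bases it loses nothing, since the whole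
  -- list has length at most `D`.
  Entry : (d ℓ D : ℕ) → List (List Sign) → ℕ → Set
  Entry d ℓ D bases r = Any (λ b → ∃[ i ] i ℕ.< D ×
    (Fits d ℓ D r (replicate i Sign.+ ++ b) ⊎ Fits d ℓ D r (replicate i Sign.- ++ b))) bases

  Table : (d ℓ D : ℕ) → List (List Sign) → Set
  Table d ℓ D bases = ∀ {r} → r ℕ.< d → Entry d ℓ D bases r

  table? : ∀ d ℓ D bases → Dec (Table d ℓ D bases)
  table? d ℓ D bases = ℕ.allUpTo? (λ r → Any.any? (λ b → ℕ.anyUpTo? (λ i →
    fits? d ℓ D r (replicate i Sign.+ ++ b) ⊎-dec fits? d ℓ D r (replicate i Sign.- ++ b)) D) bases) d

  UniversalFor : ℕ → List Sign → Set
  UniversalFor n b = ∀ {p} → Prime p → 5 ℕ.< p → p ℕ.∣ n → Universal (+ p) b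

  module _ (n d ℓ D : ℕ) .{{_ : NonZero n}} .{{_ : NonZero d}} (bases : List (List Sign)) where

    open Residues n using (Covers)

    -- Three properties of a list serve three kinds of primes: its sum modulo `d` for 2 and 3,
    -- length at least 4 for 5 (hence 3 ≤ ℓ when 5 ∣ n), and its base for larger primes. Length at
    -- least `suc ℓ` also keeps it nonempty, as lifting requires.
    table⇒covers : gcd n 24 ℕ.∣ d → Table d (suc ℓ) D bases → All (UniversalFor n) bases →
                   (5 ℕ.∣ n → 3 ℕ.≤ ℓ) → Covers D
    table⇒covers g∣d table universals 5∣n⇒ x = pick (All.lookupAny universals entry)
      where
      r : ℕ
      r = x %ℕ d
      entry : Entry d (suc ℓ) D bases r
      entry = table (n%ℕd<d x d)
      covered : ∀ s → UniversalFor n s → Fits d (suc ℓ) D r s → ∃[ s ] List.length s ℕ.≤ D × Rep (+ n) s x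
      covered [] U ((() , _) , _)
      covered s@(ε ∷ t) U ((ℓ<s , s≤D) , r≋) = s , s≤D , local-global n ε t x
        (∣-trans (pos-∣ g∣d) (≋-trans x (+ r) (signSum s) (%ℕ-≋ x d) r≋)) local
        where
        local : ∀ {p} → Prime p → 5 ℕ.≤ p → p ℕ.∣ n → Rep (+ p) s x
        local pr 5≤p p∣n with ℕ.m≤n⇒m<n∨m≡n 5≤p
        ... | inj₁ 5<p  = U pr 5<p p∣n x
        ... | inj₂ refl = universal-5 s (ℕ.≤-trans (ℕ.s≤s (5∣n⇒ p∣n)) ℓ<s) x
      pick : UniversalFor n (Any.lookup entry) × (∃[ i ] i ℕ.< D ×
               (Fits d (suc ℓ) D r (replicate i Sign.+ ++ Any.lookup entry) ⊎ Fits d (suc ℓ) D r (replicate i Sign.- ++ Any.lookup entry))) →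
             ∃[ s ] List.length s ℕ.≤ D × Rep (+ n) s x
      pick (U , i , _ , inj₁ fits) = covered _ (λ pr 5<p p∣n → Universal-replicate i Sign.+ _ (U pr 5<p p∣n)) fits
      pick (U , i , _ , inj₂ fits) = covered _ (λ pr 5<p p∣n → Universal-replicate i Sign.- _ (U pr 5<p p∣n)) fits

  -- Equal signs put before `[+-]` make a list of length 4 or more only with a sum of absolute value
  -- at least 2; the four-term base supplies 0 and ± 1. The constant triples allow lists of equal
  -- signs, without which extreme sums such as 12 modulo 24 are out of reach. Constant pairs are
  -- universal only if -1 is a square at every prime p > 5 dividing n.
  bases bases-sqrt : List (List Sign)
  bases = [+-] ∷ (Sign.+ ∷ Sign.- ∷ [+-]) ∷ [+++] ∷ [---] ∷ []
  bases-sqrt = [+-] ∷ [++] ∷ [--] ∷ []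

  universal-bases : ∀ n → All (UniversalFor n) bases
  universal-bases n = (λ pr 5<p _ → LargePrime.universal-+- pr 5<p) ∷
                       (λ pr 5<p _ → Universal-∷ Sign.+ (Sign.- ∷ [+-]) (Universal-∷ Sign.- [+-] (LargePrime.universal-+- pr 5<p))) ∷
                       (λ pr 5<p _ → universal-+++ pr 5<p) ∷
                       (λ pr 5<p _ → Universal-neg [+++] (universal-+++ pr 5<p)) ∷ []

  universal-bases-sqrt : ∀ n → (∀ {p} → Prime p → 5 ℕ.< p → p ℕ.∣ n → p % 4 ≢ 3) → All (UniversalFor n) bases-sqrt
  universal-bases-sqrt n mod4 = (λ pr 5<p _ → LargePrime.universal-+- pr 5<p) ∷
                            (λ pr 5<p p∣n → U++ pr 5<p p∣n) ∷
                            (λ pr 5<p p∣n → Universal-neg [++] (U++ pr 5<p p∣n)) ∷ []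
    where
    U++ : UniversalFor n [++]
    U++ pr 5<p p∣n = LargePrime.universal-++ pr 5<p
      (mod4⇒Sqrt-1 pr (ℕ.≤-trans (ℕ.m≤m+n 3 3) 5<p) (mod4 pr 5<p p∣n))

  table-24 : Table 24 4 12 bases
  table-24 = toWitness {a? = table? 24 4 12 bases} _

  table-12 : Table 12 4 6 bases
  table-12 = toWitness {a? = table? 12 4 6 bases} _

  table-8-5 : Table 8 4 5 bases
  table-8-5 = toWitness {a? = table? 8 4 5 bases} _

  table-6-5 : Table 6 4 5 bases
  table-6-5 = toWitness {a? = table? 6 4 5 bases} _

  table-8 : Table 8 1 4 bases
  table-8 = toWitness {a? = table? 8 1 4 bases} _

  table-6 : Table 6 1 4 bases
  table-6 = toWitness {a? = table? 6 1 4 bases} _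

  table-6-sqrt : Table 6 1 3 bases-sqrt
  table-6-sqrt = toWitness {a? = table? 6 1 3 bases-sqrt} _

  table-4-sqrt : Table 4 1 3 bases-sqrt
  table-4-sqrt = toWitness {a? = table? 4 1 3 bases-sqrt} _

  table-2 : Table 2 1 3 bases
  table-2 = toWitness {a? = table? 2 1 3 bases} _

  -- For odd n only the residue modulo 3 constrains the sum, and length 4 also settles the prime 5.
  table-3 : Table 3 4 4 bases
  table-3 = toWitness {a? = table? 3 4 4 bases} _

  -- The odd residues need a single sign, which is shorter than any base. As 4 divides 24, all units
  -- can be 1.
  covers-4 : Residues.Covers 4 2
  covers-4 x with x %ℕ 4 | n%ℕd<d x 4 | %ℕ-≋ x 4
  ... | 0 | _ | x≋ = [+-] , ℕ.≤-refl , Rep-ones [+-] x (≋-trans x 0ℤ 0ℤ x≋ (divides 0ℤ refl))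
  ... | 1 | _ | x≋ = Sign.+ ∷ [] , ℕ.m≤m+n 1 1 , Rep-ones (Sign.+ ∷ []) x x≋
  ... | 2 | _ | x≋ = [++] , ℕ.≤-refl , Rep-ones [++] x x≋
  ... | 3 | _ | x≋ = Sign.- ∷ [] , ℕ.m≤m+n 1 1 , Rep-ones (Sign.- ∷ []) x (≋-trans x (+ 3) -1ℤ x≋ (divides 1ℤ refl))
  ... | suc (suc (suc (suc _))) | ℕ.s≤s (ℕ.s≤s (ℕ.s≤s (ℕ.s≤s ()))) | _

  covers-2 : Residues.Covers 2 1
  covers-2 x with x %ℕ 2 | n%ℕd<d x 2 | %ℕ-≋ x 2
  ... | 0 | _ | x≋ = [] , ℕ.z≤n , Rep-ones [] x x≋
  ... | 1 | _ | x≋ = Sign.+ ∷ [] , ℕ.≤-refl , Rep-ones (Sign.+ ∷ []) x x≋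
  ... | suc (suc _) | ℕ.s≤s (ℕ.s≤s ()) | _

  -- Lower bounds

  -- Quantified over residues and their inverses below `d`, so that it is decided by evaluation;
  -- `unit-square` extends it to all integers.
  SquaresIn : ℕ → List Sign → Set
  SquaresIn d δs = ∀ {r} → r ℕ.< d → ∀ {r′} → r′ ℕ.< d → + r * + r′ ≋ 1ℤ [mod + d ] →
                   Any (λ δ → + r * + r ≋ sgn δ [mod + d ]) δs

  squaresIn? : ∀ d δs → Dec (SquaresIn d δs)
  squaresIn? d δs = ℕ.allUpTo? (λ r → ℕ.allUpTo? (λ r′ →
    (+ d ∣? + r * + r′ - 1ℤ) →-dec Any.any? (λ δ → + d ∣? + r * + r - sgn δ) δs) d) d

  unit-square : ∀ {d δs} .{{_ : NonZero d}} → SquaresIn d δs → ∀ {u} → Unit (+ d) u →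
                Any (λ δ → u * u ≋ sgn δ [mod + d ]) δs
  unit-square {d} squares {u} (inv v uv≋1) =
    Any.map (λ {δ} → ≋-trans (u * u) (+ r * + r) (sgn δ) (≋-* u u (+ r) (+ r) (%ℕ-≋ u d) (%ℕ-≋ u d)))
      (squares (n%ℕd<d u d) (n%ℕd<d v d)
        (≋-trans (+ r * + r′) (u * v) 1ℤ (≋-sym (u * v) (+ r * + r′) (≋-* u v (+ r) (+ r′) (%ℕ-≋ u d) (%ℕ-≋ v d))) uv≋1))
    where
    r r′ : ℕ
    r  = u %ℕ d
    r′ = v %ℕ d

  private
    absorb : ∀ x e w δ z → x - (e * δ + z) ≡ e * (w - δ) + 1ℤ * (x - e * w - z)
    absorb = ℤ.solve-∀

  sgn-* : ∀ ε δ → sgn (ε Sign.* δ) ≡ sgn ε * sgn δ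
  sgn-* Sign.+ Sign.+ = refl
  sgn-* Sign.+ Sign.- = refl
  sgn-* Sign.- Sign.+ = refl
  sgn-* Sign.- Sign.- = refl

  -- A square congruent to -1 flips its sign, so `t` may differ from `s` and only the length is
  -- kept. This treats the modulus 10, where unit squares are ± 1, like the divisors of 24.
  Rep⇒signSum : ∀ {d} .{{_ : NonZero d}} → SquaresIn d (Sign.+ ∷ Sign.- ∷ []) → ∀ s x → Rep (+ d) s x →
                ∃[ t ] List.length t ≡ List.length s × x ≋ signSum t [mod + d ]
  Rep⇒signSum squares [] x h = [] , refl , subst (_ ∣_) (sym (ℤ.+-identityʳ x)) h
  Rep⇒signSum {d} squares (ε ∷ s) x (u , unit , h) = extend (unit-square squares unit) (Rep⇒signSum squares s _ h)
    where
    cons : ∀ δ → u * u ≋ sgn δ [mod + d ] → ∃[ t ] List.length t ≡ List.length s × x - sgn ε * (u * u) ≋ signSum t [mod + d ] →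
           ∃[ t ] List.length t ≡ suc (List.length s) × x ≋ signSum t [mod + d ]
    cons δ u²≋ (t , len , x≋) = ε Sign.* δ ∷ t , cong suc len ,
      subst (λ z → x ≋ z + signSum t [mod + d ]) (sym (sgn-* ε δ))
        (∣-lin₂ (sgn ε) 1ℤ u²≋ x≋ (absorb x (sgn ε) (u * u) (sgn δ) (signSum t)))
    extend : Any (λ δ → u * u ≋ sgn δ [mod + d ]) (Sign.+ ∷ Sign.- ∷ []) →
             ∃[ t ] List.length t ≡ List.length s × x - sgn ε * (u * u) ≋ signSum t [mod + d ] →
             ∃[ t ] List.length t ≡ suc (List.length s) × x ≋ signSum t [mod + d ]
    extend (here u²≋)         = cons Sign.+ u²≋
    extend (there (here u²≋)) = cons Sign.- u²≋

  abs-signSum : ∀ s → abs (signSum s) ℕ.≤ List.length s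
  abs-signSum []      = ℕ.z≤n
  abs-signSum (ε ∷ s) = ℕ.≤-trans (ℤ.∣i+j∣≤∣i∣+∣j∣ (sgn ε) (signSum s)) (ℕ.+-mono-≤ (abs-sgn ε) (abs-signSum s))
    where
    abs-sgn : ∀ ε → abs (sgn ε) ℕ.≤ 1
    abs-sgn Sign.+ = ℕ.≤-refl
    abs-sgn Sign.- = ℕ.≤-refl

  private
    complement : ∀ c z → z ≡ 1ℤ * c + -1ℤ * (c - z)
    complement = ℤ.solve-∀

  -- Modulo 2c only steps ± 1 remain, and c is the antipode of 0 on a cycle of length 2c. With fewer
  -- than c steps the sum, a multiple of c of absolute value below c, would be 0, and 2c would
  -- divide c.
  half-needs : ∀ n .{{_ : NonZero n}} c .{{_ : NonZero c}} .{{_ : NonZero (2 ℕ.* c)}} → 2 ℕ.* c ℕ.∣ n →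
               SquaresIn (2 ℕ.* c) (Sign.+ ∷ Sign.- ∷ []) → Residues.Needs n (+ c) c
  half-needs n c 2c∣n squares s rep = ℕ.≮⇒≥ (refute (Rep⇒signSum squares s (+ c) (Rep-weaken s (+ c) (pos-∣ 2c∣n) rep)))
    where
    refute : ∃[ t ] List.length t ≡ List.length s × + c ≋ signSum t [mod + (2 ℕ.* c) ] → ¬ List.length s ℕ.< c
    refute (t , len , c≋) s<c = ℕ.<⇒≱ (ℕ.m<m+n c (subst (ℕ._> 0) (sym (ℕ.+-identityʳ c)) (ℕ.>-nonZero⁻¹ c)))
      (ℕ.∣⇒≤ (∣⇒∣ᵤ (subst (+ (2 ℕ.* c) ∣_) (trans (cong (λ z → + c - z) sum≡0) (ℤ.+-identityʳ (+ c))) c≋)))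
      where
      sum≡0 : signSum t ≡ 0ℤ
      sum≡0 = ℤ.∣i∣≡0⇒i≡0 (small-multiple {c}
        (∣⇒∣ᵤ (∣-lin₂ 1ℤ -1ℤ ∣-refl (∣-trans (pos-∣ (ℕ.n∣m*n 2)) c≋) (complement (+ c) (signSum t))))
        (ℕ.≤-<-trans (abs-signSum t) (subst (ℕ._< c) (sym len) s<c)))

  private
    1-1 : ∀ z w → 1ℤ + z - (1ℤ + w) ≡ 1ℤ * (z - w)
    1-1 = ℤ.solve-∀
    -1-1 : ∀ z w → -1ℤ + z - (1ℤ + w) ≡ 1ℤ * (z - w) + - 1ℤ * + 2
    -1-1 = ℤ.solve-∀

  signSum-parity : ∀ s → signSum s ≋ + List.length s [mod + 2 ]
  signSum-parity []           = divides 0ℤ refl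
  signSum-parity (Sign.+ ∷ s) = ∣-lin₁ 1ℤ (signSum-parity s) (1-1 (signSum s) (+ List.length s))
  signSum-parity (Sign.- ∷ s) = ∣-lin₂ 1ℤ -1ℤ (signSum-parity s) ∣-refl (-1-1 (signSum s) (+ List.length s))

  squares-2 : SquaresIn 2 (Sign.+ ∷ [])
  squares-2 = toWitness {a? = squaresIn? 2 (Sign.+ ∷ [])} _

  Rep-signSum-exact : ∀ {n} d .{{_ : NonZero d}} → d ℕ.∣ n → SquaresIn d (Sign.+ ∷ []) → ∀ s x → Rep (+ n) s x →
                      x ≋ signSum s [mod + d ]
  Rep-signSum-exact d d∣n squares s x rep = Rep-signSum one s x (Rep-weaken s x (pos-∣ d∣n) rep)
    where
    one : ∀ {u} → Unit (+ d) u → u * u ≋ 1ℤ [mod + d ]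
    one unit = Any.singleton⁻ (unit-square squares unit)

  -- Units modulo an even n are odd, so every term changes the parity: the graph is bipartite.
  Rep-parity : ∀ {n} → 2 ℕ.∣ n → ∀ s x → Rep (+ n) s x → x ≋ + List.length s [mod + 2 ]
  Rep-parity 2∣n s x rep = ≋-trans x (signSum s) (+ List.length s) (Rep-signSum-exact 2 2∣n squares-2 s x rep) (signSum-parity s)

  -- k is a nonunit, hence not a signed unit square, and it is odd.
  nonunit-needs-3 : ∀ n .{{_ : NonZero n}} k → 1 ℕ.< k → k ℕ.∣ n → 2 ℕ.∣ n → ¬ 2 ℕ.∣ k → Residues.Needs n (+ k) 3
  nonunit-needs-3 n k 1<k k∣n 2∣n 2∤k s rep = helper s rep (Rep-parity 2∣n s (+ k) rep)
    where
    even : + 2 ∣ + k → ∀ {ℓ : ℕ} → 3 ℕ.≤ ℓ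
    even 2∣k = contradiction (∣⇒∣ᵤ 2∣k) 2∤k
    parity-0 : ∀ {x} → + 2 ∣ x - 0ℤ → + 2 ∣ x
    parity-0 {x} = subst (+ 2 ∣_) (ℤ.+-identityʳ x)
    parity-2 : ∀ x → + 2 ∣ x - + 2 → + 2 ∣ x
    parity-2 x h = ∣-lin₂ 1ℤ 1ℤ h ∣-refl (split x)
      where
      split : ∀ x → x ≡ 1ℤ * (x - + 2) + 1ℤ * + 2
      split = ℤ.solve-∀
    single : ∀ ε → ¬ Rep (+ k) (ε ∷ []) (+ k)
    -- Modulo k the congruence reads ε u² ≡ 0, which a unit allows only for k = 1.
    single ε (u , inv v uv≋1 , h) = ℕ.<⇒≱ 1<k (ℕ.∣⇒≤ (∣⇒∣ᵤ k∣1))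
      where
      k∣εu² : + k ∣ sgn ε * (u * u)
      k∣εu² = ∣-lin₂ 1ℤ -1ℤ ∣-refl h (complement (+ k) (sgn ε * (u * u)))
      unsign : ∀ e u v → e * e ≡ 1ℤ → + k ∣ e * (u * u) → u * v ≋ 1ℤ [mod + k ] → + k ∣ 1ℤ
      unsign e u v e² h uv = ∣-lin₂ (e * (v * v)) (- (u * v + 1ℤ)) h uv
        (trans (split₁ u v) (trans (cong (λ z → z * (u * u * (v * v)) - (u * v + 1ℤ) * (u * v - 1ℤ)) (sym e²)) (split₂ e u v)))
        where
        split₁ : ∀ u v → 1ℤ ≡ 1ℤ * (u * u * (v * v)) - (u * v + 1ℤ) * (u * v - 1ℤ)
        split₁ = ℤ.solve-∀
        split₂ : ∀ e u v → e * e * (u * u * (v * v)) - (u * v + 1ℤ) * (u * v - 1ℤ) ≡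
                           e * (v * v) * (e * (u * u)) + - (u * v + 1ℤ) * (u * v - 1ℤ)
        split₂ = ℤ.solve-∀
      k∣1 : + k ∣ 1ℤ
      k∣1 = unsign (sgn ε) u v (sgn-square ε) k∣εu² uv≋1
    helper : ∀ s → Rep (+ n) s (+ k) → + k ≋ + List.length s [mod + 2 ] → 3 ℕ.≤ List.length s
    helper []              _ h = even (parity-0 h)
    helper (ε ∷ [])        r _ = contradiction (Rep-weaken (ε ∷ []) (+ k) (pos-∣ k∣n) r) (single ε)
    helper (_ ∷ _ ∷ [])    _ h = even (parity-2 (+ k) h)
    helper (_ ∷ _ ∷ _ ∷ _) _ _ = ℕ.m≤m+n 3 _

  -- 2p is not a sum of fewer signed squares: two equal signs fail modulo p, two distinct ones modulo d.
  prime-needs-4 : ∀ n .{{_ : NonZero n}} d .{{_ : NonZero d}} {p} → Prime p → 2 ℕ.< p → p % 4 ≡ 3 → p ℕ.∣ n →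
                  2 ℕ.∣ n → d ℕ.∣ n → SquaresIn d (Sign.+ ∷ []) → ¬ d ℕ.∣ 2 ℕ.* p → Residues.Needs n (+ (2 ℕ.* p)) 4
  prime-needs-4 n d {p} pr 2<p p%4≡3 p∣n 2∣n d∣n squares d∤2p s rep =
    helper s rep (Rep-parity 2∣n s x rep) (Rep-signSum-exact d d∣n squares s x rep)
    where
    open PrimeField pr using (P; Sqrt-1)
    x : ℤ
    x = + (2 ℕ.* p)
    2∣x : + 2 ∣ x
    2∣x = pos-∣ (ℕ.m∣m*n p)
    P∣x : P ∣ x
    P∣x = pos-∣ (ℕ.n∣m*n 2)
    mod-d : ¬ + d ∣ x - 0ℤ
    mod-d h = d∤2p (∣⇒∣ᵤ (subst (+ d ∣_) (ℤ.+-identityʳ x) h))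
    odd : ∀ k → x ≋ + k [mod + 2 ] → 2 ℕ.∣ k
    odd k h = ∣⇒∣ᵤ (∣-lin₂ 1ℤ -1ℤ 2∣x h (complement x (+ k)))
    2∤1 : ¬ 2 ℕ.∣ 1
    2∤1 = toWitnessFalse {a? = 2 ℕ.∣? 1} _
    2∤3 : ¬ 2 ℕ.∣ 3
    2∤3 = toWitnessFalse {a? = 2 ℕ.∣? 3} _
    quotient-sqrt : ∀ u v w → v * w ≋ 1ℤ [mod P ] → P ∣ u * u + v * v → P ∣ u * w * (u * w) + 1ℤ
    quotient-sqrt u v w vw h = ∣-lin₂ (w * w) (- (v * w + 1ℤ)) h vw (split u v w)
      where
      split : ∀ u v w → u * w * (u * w) + 1ℤ ≡ w * w * (u * u + v * v) + - (v * w + 1ℤ) * (v * w - 1ℤ)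
      split = ℤ.solve-∀
    no-sqrt : ∀ u v → Unit P v → ¬ P ∣ u * u + v * v
    -- u / v would be a square root of -1, against p ≡ 3 (mod 4).
    no-sqrt u v (inv w vw≋1) h = mod4⇒¬Sqrt-1 pr 2<p p%4≡3 (u * w , quotient-sqrt u v w vw≋1 h)
    split++ : ∀ x u v → u * u + v * v ≡ 1ℤ * x + -1ℤ * (x - 1ℤ * (u * u) - 1ℤ * (v * v))
    split++ = ℤ.solve-∀
    splitnn : ∀ x u v → u * u + v * v ≡ -1ℤ * x + 1ℤ * (x - -1ℤ * (u * u) - -1ℤ * (v * v))
    splitnn = ℤ.solve-∀
    no++ : ¬ Rep P [++] x
    no++ (u , _ , v , unit , h) = no-sqrt u v unit (∣-lin₂ 1ℤ -1ℤ P∣x h (split++ x u v))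
    no-- : ¬ Rep P [--] x
    no-- (u , _ , v , unit , h) = no-sqrt u v unit (∣-lin₂ -1ℤ 1ℤ P∣x h (splitnn x u v))
    helper : ∀ s → Rep (+ n) s x → x ≋ + List.length s [mod + 2 ] → x ≋ signSum s [mod + d ] → 4 ℕ.≤ List.length s
    helper []                       r h h′ = contradiction h′ mod-d
    helper (_ ∷ [])                 r h h′ = contradiction (odd 1 h) 2∤1
    helper (Sign.+ ∷ Sign.+ ∷ [])   r h h′ = contradiction (Rep-weaken [++] x (pos-∣ p∣n) r) no++
    helper (Sign.- ∷ Sign.- ∷ [])   r h h′ = contradiction (Rep-weaken [--] x (pos-∣ p∣n) r) no--
    helper (Sign.+ ∷ Sign.- ∷ [])   r h h′ = contradiction h′ mod-d
    helper (Sign.- ∷ Sign.+ ∷ [])   r h h′ = contradiction h′ mod-d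
    helper (_ ∷ _ ∷ _ ∷ [])         r h h′ = contradiction (odd 3 h) 2∤3
    helper (_ ∷ _ ∷ _ ∷ _ ∷ _)      r h h′ = ℕ.m≤m+n 4 _

open import Data.Bool.Base using (true; false)
open import Data.Integer.Base using (+_)
open import Data.List.Base using ([]; _∷_)
open import Data.Nat.Base
open import Data.Nat.Coprimality as Coprime using (Coprime; coprime-divisor)
open import Data.Nat.Divisibility
open import Data.Nat.DivMod using (_%_)
open import Data.Nat.GCD using (gcd; gcd[m,n]∣m; gcd[m,n]∣n)
open import Data.Nat.Primality
open import Data.Nat.Properties
open import Data.Nat.Tactic.RingSolver using (solve-∀)
open import Data.Product.Base using (_×_; _,_; ∃-syntax)
open import Data.Sign.Base as Sign using (Sign)
open import Data.Sum.Base using (_⊎_; inj₁; inj₂; [_,_]′; fromInj₂)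
open import Function.Base using (_∘_; id)
open import Relation.Binary.PropositionalEquality
open import Relation.Nullary
open import Relation.Nullary.Decidable
open Representations

-- Divisors of 24 and coprimality

prime[3] : Prime 3
prime[3] = toWitness {a? = prime? 3} _

prime[5] : Prime 5
prime[5] = toWitness {a? = prime? 5} _

-- On the right of each alternative stands the largest divisor of 24 that avoids the divisors on the
-- left. Disjunctions in place of implications carry the positive information that the case
-- distinctions consume.
record Divisor24 (g : ℕ) : Set where
  field
    ∤2    : 2 ∣ g ⊎ g ∣ 3
    ∤3    : 3 ∣ g ⊎ g ∣ 8
    ∤4    : 4 ∣ g ⊎ g ∣ 6
    ∤8    : 8 ∣ g ⊎ g ∣ 12
    ∤4∧∤3 : (4 ∣ g ⊎ 3 ∣ g) ⊎ g ∣ 2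
    ∤8∧∤3 : (8 ∣ g ⊎ 3 ∣ g) ⊎ g ∣ 4

∣24⇒ : ∀ {g} → g ∣ 24 → Divisor24 g
∣24⇒ {g} g∣24 = let a , b , c , d , e , f = check (s≤s (∣⇒≤ g∣24)) g∣24 in
  record { ∤2 = a ; ∤3 = b ; ∤4 = c ; ∤8 = d ; ∤4∧∤3 = e ; ∤8∧∤3 = f }
  where
  P : ℕ → Set
  P g = (2 ∣ g ⊎ g ∣ 3) × (3 ∣ g ⊎ g ∣ 8) × (4 ∣ g ⊎ g ∣ 6) × (8 ∣ g ⊎ g ∣ 12) ×
        ((4 ∣ g ⊎ 3 ∣ g) ⊎ g ∣ 2) × ((8 ∣ g ⊎ 3 ∣ g) ⊎ g ∣ 4)
  P? : ∀ g → Dec (P g)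
  P? g = (2 ∣? g ⊎-dec g ∣? 3) ×-dec (3 ∣? g ⊎-dec g ∣? 8) ×-dec (4 ∣? g ⊎-dec g ∣? 6) ×-dec (8 ∣? g ⊎-dec g ∣? 12) ×-dec
         ((4 ∣? g ⊎-dec 3 ∣? g) ⊎-dec g ∣? 2) ×-dec ((8 ∣? g ⊎-dec 3 ∣? g) ⊎-dec g ∣? 4)
  check : ∀ {g} → g < 25 → g ∣ 24 → P g
  check = toWitness {a? = allUpTo? (λ g → g ∣? 24 →-dec P? g) 25} _

module _ (n : ℕ) where

  private
    g : ℕ
    g = gcd n 24
    facts : Divisor24 g
    facts = ∣24⇒ (gcd[m,n]∣n n 24)
    g∤ : ∀ {k} → ¬ k ∣ n → ¬ k ∣ g
    g∤ k∤n k∣g = k∤n (∣-trans k∣g (gcd[m,n]∣m n 24))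
  open Divisor24 facts

  gcd∣3 : ¬ 2 ∣ n → gcd n 24 ∣ 3
  gcd∣3 2∤n = fromInj₂ (λ h → contradiction h (g∤ 2∤n)) ∤2

  gcd∣8 : ¬ 3 ∣ n → gcd n 24 ∣ 8
  gcd∣8 3∤n = fromInj₂ (λ h → contradiction h (g∤ 3∤n)) ∤3

  gcd∣6 : ¬ 4 ∣ n → gcd n 24 ∣ 6
  gcd∣6 4∤n = fromInj₂ (λ h → contradiction h (g∤ 4∤n)) ∤4

  gcd∣12 : ¬ 8 ∣ n → gcd n 24 ∣ 12
  gcd∣12 8∤n = fromInj₂ (λ h → contradiction h (g∤ 8∤n)) ∤8

  gcd∣2 : ¬ 4 ∣ n → ¬ 3 ∣ n → gcd n 24 ∣ 2
  gcd∣2 4∤n 3∤n = fromInj₂ [ (λ h → contradiction h (g∤ 4∤n)) , (λ h → contradiction h (g∤ 3∤n)) ]′ ∤4∧∤3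

  gcd∣4 : ¬ 8 ∣ n → ¬ 3 ∣ n → gcd n 24 ∣ 4
  gcd∣4 8∤n 3∤n = fromInj₂ [ (λ h → contradiction h (g∤ 8∤n)) , (λ h → contradiction h (g∤ 3∤n)) ]′ ∤8∧∤3

δ₃-yes : ∀ n .{{_ : NonZero n}} → HasPrimeFactor3mod4 n → δ₃ n ≡ 1
δ₃-yes n h rewrite dec-true (hasPrimeFactor3mod4? n) h = refl

δ₃-no : ∀ n .{{_ : NonZero n}} → ¬ HasPrimeFactor3mod4 n → δ₃ n ≡ 0
δ₃-no n h rewrite dec-false (hasPrimeFactor3mod4? n) h = refl

δ₃≤1 : ∀ n .{{_ : NonZero n}} → δ₃ n ≤ 1
δ₃≤1 n with does (hasPrimeFactor3mod4? n)
... | true  = ≤-refl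
... | false = z≤n

coprime-* : ∀ {K a b} → Coprime K a → Coprime K b → Coprime K (a * b)
coprime-* {K} {a} {b} ca cb {i} (i∣K , i∣ab) = cb (i∣K , coprime-divisor i-a i∣ab)
  where
  i-a : Coprime i a
  i-a (j∣i , j∣a) = ca (∣-trans j∣i i∣K , j∣a)

∤⇒coprime : ∀ {K p} → Prime p → ¬ p ∣ K → Coprime K p
∤⇒coprime pr p∤K = Coprime.sym (prime∤⇒coprime pr p∤K)

prime∣^ : ∀ {q} p m → Prime q → q ∣ p ^ m → q ∣ p
prime∣^ p zero    pr q∣1 = contradiction (subst Prime (∣1⇒≡1 q∣1) pr) ¬prime[1]
prime∣^ p (suc m) pr q∣  = [ id , prime∣^ p m pr ]′ (euclidsLemma p (p ^ m) pr q∣)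

prime∣prime : ∀ {p q} → Prime p → Prime q → q ∣ p → q ≡ p
prime∣prime pp pq q∣p = fromInj₂ (λ q≡1 → contradiction (subst Prime q≡1 pq) ¬prime[1]) (prime⇒irreducible pp q∣p)

∤-* : ∀ {p} c K → Prime p → ¬ p ∣ c → ¬ p ∣ K → ¬ p ∣ c * K
∤-* c K pr p∤c p∤K = [ p∤c , p∤K ]′ ∘ euclidsLemma c K pr

prime-*∣ : ∀ {p} c {n} → Prime p → ¬ p ∣ c → p ∣ n → c ∣ n → p * c ∣ n
prime-*∣ {p} c pr p∤c (divides q n≡) c∣n = subst (p * c ∣_) (sym n≡pq)
  (*-monoʳ-∣ p (coprime-divisor (∤⇒coprime pr p∤c) (subst (c ∣_) n≡pq c∣n)))
  where
  n≡pq : _ ≡ p * q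
  n≡pq = trans n≡ (*-comm q p)

-- Diameters row by row

squares-24 : SquaresIn 24 (Sign.+ ∷ Sign.- ∷ [])
squares-24 = toWitness {a? = squaresIn? 24 (Sign.+ ∷ Sign.- ∷ [])} _

squares-12 : SquaresIn 12 (Sign.+ ∷ Sign.- ∷ [])
squares-12 = toWitness {a? = squaresIn? 12 (Sign.+ ∷ Sign.- ∷ [])} _

squares-10 : SquaresIn 10 (Sign.+ ∷ Sign.- ∷ [])
squares-10 = toWitness {a? = squaresIn? 10 (Sign.+ ∷ Sign.- ∷ [])} _

squares-8 : SquaresIn 8 (Sign.+ ∷ Sign.- ∷ [])
squares-8 = toWitness {a? = squaresIn? 8 (Sign.+ ∷ Sign.- ∷ [])} _

squares-6 : SquaresIn 6 (Sign.+ ∷ Sign.- ∷ [])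
squares-6 = toWitness {a? = squaresIn? 6 (Sign.+ ∷ Sign.- ∷ [])} _

squares-4 : SquaresIn 4 (Sign.+ ∷ Sign.- ∷ [])
squares-4 = toWitness {a? = squaresIn? 4 (Sign.+ ∷ Sign.- ∷ [])} _

squares-2± : SquaresIn 2 (Sign.+ ∷ Sign.- ∷ [])
squares-2± = toWitness {a? = squaresIn? 2 (Sign.+ ∷ Sign.- ∷ [])} _

squares-6+ : SquaresIn 6 (Sign.+ ∷ [])
squares-6+ = toWitness {a? = squaresIn? 6 (Sign.+ ∷ [])} _

squares-4+ : SquaresIn 4 (Sign.+ ∷ [])
squares-4+ = toWitness {a? = squaresIn? 4 (Sign.+ ∷ [])} _

module _ (n : ℕ) .{{_ : NonZero n}} where

  open Residues n

  diameter-24 : 24 ∣ n → HasDiameter (G n) 12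
  diameter-24 24∣n = diameter (table⇒covers n 24 3 12 bases (gcd[m,n]∣n n 24) table-24 (universal-bases n) (λ _ → ≤-refl))
    (+ 12) (half-needs n 12 24∣n squares-24)

  diameter-12 : 12 ∣ n → ¬ 8 ∣ n → HasDiameter (G n) 6
  diameter-12 12∣n 8∤n = diameter (table⇒covers n 12 3 6 bases (gcd∣12 n 8∤n) table-12 (universal-bases n) (λ _ → ≤-refl))
    (+ 6) (half-needs n 6 12∣n squares-12)

  diameter-10 : 10 ∣ n → ¬ 12 ∣ n → HasDiameter (G n) 5
  diameter-10 10∣n 12∤n = diameter (helper (3 ∣? n)) (+ 5) (half-needs n 5 10∣n squares-10)
    where
    helper : Dec (3 ∣ n) → Covers 5
    -- As 12 ∤ n, one of 3 and 4 does not divide n, and the gcd with 24 divides 8 or 6.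
    helper (no  3∤n) = table⇒covers n 8 3 5 bases (gcd∣8 n 3∤n) table-8-5 (universal-bases n) (λ _ → ≤-refl)
    helper (yes 3∣n) = table⇒covers n 6 3 5 bases (gcd∣6 n 4∤n) table-6-5 (universal-bases n) (λ _ → ≤-refl)
      where
      4∤n : ¬ 4 ∣ n
      4∤n 4∣n = 12∤n (prime-*∣ 4 prime[3] (toWitnessFalse {a? = 3 ∣? 4} _) 3∣n 4∣n)

  -- Modulo 8 and modulo 6 sums of at most four signs reach every residue. The bound serves the
  -- multiples of 8, the rows with `δ₃ n` equal to 1 and the powers of 2.
  covers-4-cases : ¬ 5 ∣ n → ¬ 3 ∣ n ⊎ ¬ 4 ∣ n → Covers 4
  covers-4-cases 5∤n (inj₁ 3∤n) = table⇒covers n 8 0 4 bases (gcd∣8 n 3∤n) table-8 (universal-bases n) (λ h → contradiction h 5∤n)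
  covers-4-cases 5∤n (inj₂ 4∤n) = table⇒covers n 6 0 4 bases (gcd∣6 n 4∤n) table-6 (universal-bases n) (λ h → contradiction h 5∤n)

  covers-odd : ¬ 2 ∣ n → Covers 4
  covers-odd 2∤n = table⇒covers n 3 3 4 bases (gcd∣3 n 2∤n) table-3 (universal-bases n) (λ _ → ≤-refl)

  diameter-8 : 8 ∣ n → ¬ 3 ∣ n → ¬ 5 ∣ n → HasDiameter (G n) 4
  diameter-8 8∣n 3∤n 5∤n = diameter (covers-4-cases 5∤n (inj₁ 3∤n)) (+ 4) (half-needs n 4 8∣n squares-8)

  no-3mod4 : ¬ HasPrimeFactor3mod4 n → ∀ {p} → Prime p → 5 < p → p ∣ n → p % 4 ≢ 3
  no-3mod4 none pr 5<p p∣n p%4≡3 = none (_ , pr , p∣n , ≤-trans (m≤m+n 4 2) 5<p , p%4≡3)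

  diameter-6 : 6 ∣ n → ¬ 4 ∣ n → ¬ 5 ∣ n → HasDiameter (G n) (3 + δ₃ n)
  diameter-6 6∣n 4∤n 5∤n = helper (hasPrimeFactor3mod4? n)
    where
    2∣n : 2 ∣ n
    2∣n = ∣-trans (divides 3 refl) 6∣n
    helper : Dec (HasPrimeFactor3mod4 n) → HasDiameter (G n) (3 + δ₃ n)
    helper (yes h@(p , pr , p∣n , p>3 , p%4≡3)) = subst (λ δ → HasDiameter (G n) (3 + δ)) (sym (δ₃-yes n h))
      (diameter (covers-4-cases 5∤n (inj₂ 4∤n)) (+ (2 * p))
        (prime-needs-4 n 6 pr (<⇒≤ p>3) p%4≡3 p∣n 2∣n 6∣n squares-6+
          -- 6 ∣ 2p would give 3 ∣ p, so p = 3; the prime 3 itself does not count in `δ₃`.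
          (λ 6∣2p → <⇒≢ p>3 (prime∣prime pr prime[3] (*-cancelˡ-∣ 2 6∣2p)))))
    helper (no none) = subst (λ δ → HasDiameter (G n) (3 + δ)) (sym (δ₃-no n none))
      (diameter (table⇒covers n 6 0 3 bases-sqrt (gcd∣6 n 4∤n) table-6-sqrt (universal-bases-sqrt n (no-3mod4 none))
                  (λ h → contradiction h 5∤n))
        (+ 3) (half-needs n 3 6∣n squares-6))

  diameter-4 : ∀ K → 1 < K → K ∣ n → ¬ 2 ∣ K → 4 ∣ n → ¬ 8 ∣ n → ¬ 3 ∣ n → ¬ 5 ∣ n → HasDiameter (G n) (3 + δ₃ n)
  diameter-4 K 1<K K∣n 2∤K 4∣n 8∤n 3∤n 5∤n = helper (hasPrimeFactor3mod4? n)
    where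
    2∣n : 2 ∣ n
    2∣n = ∣-trans (divides 2 refl) 4∣n
    helper : Dec (HasPrimeFactor3mod4 n) → HasDiameter (G n) (3 + δ₃ n)
    helper (yes h@(p , pr , p∣n , p>3 , p%4≡3)) = subst (λ δ → HasDiameter (G n) (3 + δ)) (sym (δ₃-yes n h))
      (diameter (covers-4-cases 5∤n (inj₁ 3∤n)) (+ (2 * p))
        (prime-needs-4 n 4 pr (<⇒≤ p>3) p%4≡3 p∣n 2∣n 4∣n squares-4+
          (λ 4∣2p → <⇒≢ (<⇒≤ p>3) (prime∣prime pr prime[2] (*-cancelˡ-∣ 2 4∣2p)))))
    helper (no none) = subst (λ δ → HasDiameter (G n) (3 + δ)) (sym (δ₃-no n none))
      (diameter (table⇒covers n 4 0 3 bases-sqrt (gcd∣4 n 8∤n 3∤n) table-4-sqrt (universal-bases-sqrt n (no-3mod4 none))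
                  (λ h → contradiction h 5∤n))
        -- The antipode of 0 modulo 4 would yield only 2, so the odd nonunit K takes its place.
        (+ K) (nonunit-needs-3 n K 1<K K∣n 2∣n 2∤K))

  diameter-2 : ∀ K → 1 < K → K ∣ n → ¬ 2 ∣ K → 2 ∣ n → ¬ 4 ∣ n → ¬ 3 ∣ n → ¬ 5 ∣ n → HasDiameter (G n) 3
  diameter-2 K 1<K K∣n 2∤K 2∣n 4∤n 3∤n 5∤n =
    diameter (table⇒covers n 2 0 3 bases (gcd∣2 n 4∤n 3∤n) table-2 (universal-bases n) (λ h → contradiction h 5∤n))
      (+ K) (nonunit-needs-3 n K 1<K K∣n 2∣n 2∤K)

module _ {n} (c K : ℕ) (n≡ : n ≡ c * K) where

  factor∣ : c ∣ n
  factor∣ = divides K (trans n≡ (*-comm c K))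

  cofactor∣ : K ∣ n
  cofactor∣ = divides c n≡

  multiple∤ : ∀ {p} → Prime p → ¬ p ∣ c → ¬ p ∣ K → ¬ p ∣ n
  multiple∤ {p} pr p∤c p∤K = subst (λ z → ¬ p ∣ z) (sym n≡) (∤-* c K pr p∤c p∤K)

coprime⇒∤ : ∀ {K m p} → Prime p → p ∣ m → Coprime K m → ¬ p ∣ K
coprime⇒∤ pr p∣m c p∣K = ¬prime[1] (subst Prime (c (p∣K , p∣m)) pr)

evenCase-diameter : ∀ n .{{_ : NonZero n}} d → EvenCase n d → HasDiameter (G n) d
evenCase-diameter n _ (multiple-of-24 24∣n) = diameter-24 n 24∣n
evenCase-diameter n _ (odd-multiple-of-12 k n≡) = diameter-12 n 12∣n 8∤n
  where
  12∣n : 12 ∣ n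
  12∣n = divides (2 * k + 1) n≡
  8∤n : ¬ 8 ∣ n
  -- Together with 3 ∣ n it would give 24 ∣ (2k + 1) · 12, making 2k + 1 even.
  8∤n 8∣n = contradiction
    (∣m+n∣m⇒∣n (*-cancelʳ-∣ 12 (subst (24 ∣_) n≡ (prime-*∣ 8 prime[3] (toWitnessFalse {a? = 3 ∣? 8} _) (∣-trans (divides 4 refl) 12∣n) 8∣n))) (m∣m*n k))
    (toWitnessFalse {a? = 2 ∣? 1} _)
evenCase-diameter n _ (multiple-of-10 10∣n 12∤n) = diameter-10 n 10∣n 12∤n
evenCase-diameter n _ (form-8K K K>0 c n≡) = diameter-8 n (factor∣ 8 K n≡)
  (multiple∤ 8 K n≡ prime[3] (toWitnessFalse {a? = 3 ∣? 8} _) (coprime⇒∤ prime[3] (divides 5 refl) c))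
  (multiple∤ 8 K n≡ prime[5] (toWitnessFalse {a? = 5 ∣? 8} _) (coprime⇒∤ prime[5] (divides 3 refl) c))
evenCase-diameter n _ (form-6K K K>0 c n≡) = diameter-6 n (factor∣ 6 K n≡) 4∤n
  (multiple∤ 6 K n≡ prime[5] (toWitnessFalse {a? = 5 ∣? 6} _) (coprime⇒∤ prime[5] (divides 2 refl) c))
  where
  4∤n : ¬ 4 ∣ n
  4∤n 4∣n = ∤-* 3 K prime[2] (toWitnessFalse {a? = 2 ∣? 3} _) (coprime⇒∤ prime[2] (divides 5 refl) c)
    (*-cancelˡ-∣ 2 (subst (4 ∣_) (trans n≡ (*-assoc 2 3 K)) 4∣n))
evenCase-diameter n _ (form-4K K K>1 c n≡) = diameter-4 n K K>1 (cofactor∣ 4 K n≡) 2∤K (factor∣ 4 K n≡)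
  (λ 8∣n → 2∤K (*-cancelˡ-∣ 4 (subst (8 ∣_) n≡ 8∣n)))
  (multiple∤ 4 K n≡ prime[3] (toWitnessFalse {a? = 3 ∣? 4} _) (coprime⇒∤ prime[3] (divides 10 refl) c))
  (multiple∤ 4 K n≡ prime[5] (toWitnessFalse {a? = 5 ∣? 4} _) (coprime⇒∤ prime[5] (divides 6 refl) c))
  where
  2∤K : ¬ 2 ∣ K
  2∤K = coprime⇒∤ prime[2] (divides 15 refl) c
evenCase-diameter n _ (form-2K K K>1 c n≡) = diameter-2 n K K>1 (cofactor∣ 2 K n≡) 2∤K (factor∣ 2 K n≡)
  (λ 4∣n → 2∤K (*-cancelˡ-∣ 2 (subst (4 ∣_) n≡ 4∣n)))
  (multiple∤ 2 K n≡ prime[3] (toWitnessFalse {a? = 3 ∣? 2} _) (coprime⇒∤ prime[3] (divides 10 refl) c))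
  (multiple∤ 2 K n≡ prime[5] (toWitnessFalse {a? = 5 ∣? 2} _) (coprime⇒∤ prime[5] (divides 6 refl) c))
  where
  2∤K : ¬ 2 ∣ K
  2∤K = coprime⇒∤ prime[2] (divides 15 refl) c
evenCase-diameter n _ (is-4 refl) = Residues.diameter 4 covers-4 (+ 2) (half-needs 4 2 ∣-refl squares-4)
evenCase-diameter n _ (is-2 refl) = Residues.diameter 2 covers-2 (+ 1) (half-needs 2 1 ∣-refl squares-2±)

-- Exhaustiveness of the rows and uniform bounds

module _ {K : ℕ} where

  coprime-10 : ¬ 2 ∣ K → ¬ 5 ∣ K → Coprime K 10
  coprime-10 2∤K 5∤K = coprime-* {a = 2} (∤⇒coprime prime[2] 2∤K) (∤⇒coprime prime[5] 5∤K)

  coprime-15 : ¬ 3 ∣ K → ¬ 5 ∣ K → Coprime K 15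
  coprime-15 3∤K 5∤K = coprime-* {a = 3} (∤⇒coprime prime[3] 3∤K) (∤⇒coprime prime[5] 5∤K)

  coprime-30 : ¬ 2 ∣ K → ¬ 3 ∣ K → ¬ 5 ∣ K → Coprime K 30
  coprime-30 2∤K 3∤K 5∤K = coprime-* {a = 2} (∤⇒coprime prime[2] 2∤K) (coprime-15 3∤K 5∤K)

quotient>0 : ∀ {n} .{{_ : NonZero n}} q m → n ≡ m * q → q > 0
quotient>0 {n} q m n≡ = n≢0⇒n>0 (λ q≡0 → ≢-nonZero⁻¹ n (trans n≡ (trans (cong (m *_) q≡0) (*-zeroʳ m))))

-- The rows are tried from top to bottom, and the failure of earlier ones makes the quotient coprime
-- to the required primes: for instance 12 ∤ n makes n / 6 odd, and 10 ∤ n excludes 5 because n is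
-- even.
evenCase : ∀ n .{{_ : NonZero n}} → 2 ∣ n → ∃[ d ] EvenCase n d
evenCase n 2∣n with 24 ∣? n
... | yes 24∣n = 12 , multiple-of-24 24∣n
... | no  24∤n with 12 ∣? n
...   | yes (divides q n≡) = 6 , [ (λ (k , q≡) → contradiction (even k q≡) 24∤n) , (λ (k , q≡) → odd-multiple-of-12 k (odd k q≡)) ]′ (double-cases q)
  where
  even : ∀ k → q ≡ k + k → 24 ∣ n
  even k q≡ = divides k (trans n≡ (trans (cong (_* 12) q≡) (k+k*12 k)))
    where
    k+k*12 : ∀ k → (k + k) * 12 ≡ k * 24
    k+k*12 = solve-∀
  odd : ∀ k → q ≡ suc (k + k) → n ≡ (2 * k + 1) * 12
  odd k q≡ = trans n≡ (trans (cong (_* 12) q≡) (1+k+k*12 k))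
    where
    1+k+k*12 : ∀ k → suc (k + k) * 12 ≡ (2 * k + 1) * 12
    1+k+k*12 = solve-∀
...   | no 12∤n with 10 ∣? n
...     | yes 10∣n = 5 , multiple-of-10 10∣n 12∤n
...     | no  10∤n = remaining (8 ∣? n) (3 ∣? n) (4 ∣? n) 2∣n
  where
  5∤ : ¬ 5 ∣ n
  5∤ 5∣n = 10∤n (prime-*∣ 2 prime[5] (toWitnessFalse {a? = 5 ∣? 2} _) 5∣n 2∣n)
  ∤quotient : ∀ {p} q c → n ≡ q * c → ¬ p ∣ n → ¬ p ∣ q
  ∤quotient q c n≡ p∤n p∣q = p∤n (subst (_ ∣_) (sym n≡) (∣m⇒∣m*n c p∣q))
  *∣quotient : ∀ {p} q c → n ≡ q * c → p ∣ q → p * c ∣ n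
  *∣quotient q c n≡ p∣q = subst (_ ∣_) (sym n≡) (*-monoˡ-∣ c p∣q)
  swap : ∀ q c → n ≡ q * c → n ≡ c * q
  swap q c n≡ = trans n≡ (*-comm q c)
  large : ∀ q c → n ≡ q * c → q ≢ 1 → q > 1
  large q c n≡ q≢1 = ≤∧≢⇒< (quotient>0 q c (swap q c n≡)) (λ 1≡q → q≢1 (sym 1≡q))
  remaining : Dec (8 ∣ n) → Dec (3 ∣ n) → Dec (4 ∣ n) → 2 ∣ n → ∃[ d ] EvenCase n d
  remaining (yes (divides q n≡)) _ _ _ = 4 , form-8K q (quotient>0 q 8 (swap q 8 n≡))
    (coprime-15 (λ 3∣q → 24∤n (*∣quotient q 8 n≡ 3∣q)) (∤quotient q 8 n≡ 5∤)) (swap q 8 n≡)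
  remaining (no 8∤n) (yes 3∣n) _ 2∣n = six (prime-*∣ 2 prime[3] (toWitnessFalse {a? = 3 ∣? 2} _) 3∣n 2∣n)
    where
    six : 6 ∣ n → ∃[ d ] EvenCase n d
    six (divides q n≡) = 3 + δ₃ n , form-6K q (quotient>0 q 6 (swap q 6 n≡))
      (coprime-10 (λ 2∣q → 12∤n (*∣quotient q 6 n≡ 2∣q)) (∤quotient q 6 n≡ 5∤)) (swap q 6 n≡)
  remaining (no 8∤n) (no 3∤n) (yes (divides q n≡)) _ with q ≟ 1
  ... | yes q≡1 = 2 , is-4 (trans n≡ (cong (_* 4) q≡1))
  ... | no  q≢1 = 3 + δ₃ n , form-4K q (large q 4 n≡ q≢1)
    (coprime-30 (λ 2∣q → 8∤n (*∣quotient q 4 n≡ 2∣q)) (∤quotient q 4 n≡ 3∤n) (∤quotient q 4 n≡ 5∤)) (swap q 4 n≡)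
  remaining (no 8∤n) (no 3∤n) (no 4∤n) (divides q n≡) with q ≟ 1
  ... | yes q≡1 = 1 , is-2 (trans n≡ (cong (_* 2) q≡1))
  ... | no  q≢1 = 3 , form-2K q (large q 2 n≡ q≢1)
    (coprime-30 (λ 2∣q → 4∤n (*∣quotient q 2 n≡ 2∣q)) (∤quotient q 2 n≡ 3∤n) (∤quotient q 2 n≡ 5∤)) (swap q 2 n≡)

evenCase≤12 : ∀ {n} .{{_ : NonZero n}} {d} → EvenCase n d → d ≤ 12
evenCase≤12 (multiple-of-24 _)         = ≤-refl
evenCase≤12 (odd-multiple-of-12 _ _)   = m≤m+n 6 6
evenCase≤12 (multiple-of-10 _ _)       = m≤m+n 5 7
evenCase≤12 (form-8K _ _ _ _)          = m≤m+n 4 8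
evenCase≤12 {n} (form-6K _ _ _ _)      = ≤-trans (+-monoʳ-≤ 3 (δ₃≤1 n)) (m≤m+n 4 8)
evenCase≤12 {n} (form-4K _ _ _ _)      = ≤-trans (+-monoʳ-≤ 3 (δ₃≤1 n)) (m≤m+n 4 8)
evenCase≤12 (form-2K _ _ _ _)          = m≤m+n 3 9
evenCase≤12 (is-4 _)                   = m≤m+n 2 10
evenCase≤12 (is-2 _)                   = m≤m+n 1 11

diameter≤12 : ∀ n .{{_ : NonZero n}} → ∃[ d ] HasDiameter (G n) d × d ≤ 12
diameter≤12 n with 2 ∣? n
... | yes 2∣n = let d , case = evenCase n 2∣n in d , evenCase-diameter n d case , evenCase≤12 case
... | no  2∤n = let d , diam , d≤4 = Residues.covers⇒diameter≤ n (covers-odd n 2∤n) in d , diam , ≤-trans d≤4 (m≤m+n 4 8)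

-- Powers of odd primes are odd, and powers of 2 are divisible by neither 3 nor 5; both arguments
-- include m = 0.
prime-power-diameter≤4 : ∀ p m (p-prime : Prime p) →
  ∃[ d ] HasDiameter (G (p ^ m) {{m^n≢0 p m {{prime⇒nonZero p-prime}}}}) d × d ≤ 4
prime-power-diameter≤4 p m p-prime = Residues.covers⇒diameter≤ (p ^ m) (covers (2 ∣? p))
  where
  instance
    p^m≢0 : NonZero (p ^ m)
    p^m≢0 = m^n≢0 p m {{prime⇒nonZero p-prime}}
  covers : Dec (2 ∣ p) → Residues.Covers (p ^ m) 4
  covers (no  2∤p) = covers-odd (p ^ m) (2∤p ∘ prime∣^ p m prime[2])
  covers (yes 2∣p) = covers-4-cases (p ^ m) (∤power prime[5] (λ ())) (inj₁ (∤power prime[3] (λ ())))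
    where
    ∤power : ∀ {q} → Prime q → q ≢ 2 → ¬ q ∣ p ^ m
    ∤power {q} pr q≢2 q∣ = q≢2 (trans (prime∣prime p-prime pr (prime∣^ p m pr q∣)) (sym (prime∣prime p-prime prime[2] 2∣p)))

theorem10 : (∀ (n : ℕ) .{{_ : NonZero n}} → 2 ∣ n →
    (∃[ d ] EvenCase n d) × (∀ d → EvenCase n d → HasDiameter (G n) d))
    × (∀ (n : ℕ) .{{_ : NonZero n}} → ∃[ d ] HasDiameter (G n) d × d ≤ 12)
    × (∀ (p m : ℕ) (p-prime : Prime p) →
    ∃[ d ] HasDiameter (G (p ^ m) {{m^n≢0 p m {{prime⇒nonZero p-prime}}}}) d × d ≤ 4)
theorem10 = (λ n 2∣n → evenCase n 2∣n , evenCase-diameter n) , diameter≤12 , prime-power-diameter≤4
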